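{- The homomorphism $P:M_\infty\to\mathbb{Z}_2^\times$, $\sigma\mapsto P(\sigma,x_0)$, is surjective, and there is a short exact sequence \[ 0\to\overline{B}_\infty\to M_\infty\xrightarrow{P}\mathbb{Z}_2^\times\to0. \] In addition, for each $n\ge1$, with $j:=\lfloor(n+1)/2\rfloor$, there is a short exact sequence \[ 0\to B_n\to M_n\xrightarrow{P}(\mathbb{Z}/2^j\mathbb{Z})^\times\to0, \] where $P(\sigma)=P(\sigma,x_0)$. Moreover, $|M_n|=2^{m_n}$, where \[ m_n=\frac{2^{n+1}}{3}+n-\begin{cases}5/3 & n\text{ even},\\ 4/3 & n\text{ odd}.\end{cases} \]
   Context: $T_\infty$ is the infinite binary rooted tree whose nodes at level $m\ge0$ are words of length $m$ over $\{a,b\}$ (root $x_0$ = empty word), each $w$ joined to $wa,wb$; $T_n$ the subtree of words of length $\le n$; $\mathrm{Aut}(T_\infty),\mathrm{Aut}(T_n)$ the root-preserving automorphism groups; $\mathrm{Aut}(T_\infty)$ carries the profinite topology whose basic open sets are cosets of the subgroups fixing all nodes of length $\le m$. $\mathrm{Par}(\sigma,x)=0$ if $\sigma(xa)=\sigma(x)a$ and $\sigma(xb)=\sigma(x)b$, and $=1$ if $\sigma(xa)=\sigma(x)b$ and $\sigma(xb)=\sigma(x)a$. For $\sigma\in\mathrm{Aut}(T_\infty)$: $Q(\sigma,x):=\sum_{i\ge0}2^i\sum_{s_1,\ldots,s_i\in\{a,b\}}\mathrm{Par}(\sigma,x\,a\,s_1\,a\,s_2\cdots a\,s_i)\in\mathbb{Z}_2$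 (concatenated words), $P(\sigma,x):=(-1)^{\mathrm{Par}(\sigma,x)}+2\sum_{t\in\{a,b\}}Q(\sigma,xbt)-2\sum_{t\in\{a,b\}}Q(\sigma,xat)\in\mathbb{Z}_2^\times$. For $\tau\in\mathrm{Aut}(T_n)$ and $x$ of length $m\le n$, $P(\tau,x):=P(\tilde\tau,x)\bmod 2^{\lfloor(n-m+1)/2\rfloor}$ for any extension $\tilde\tau$ of $\tau$ to $T_\infty$. $M_\infty:=\{\sigma\in\mathrm{Aut}(T_\infty):P(\sigma,x)=P(\sigma,x_0)\ \forall x\}$; $M_n:=\{\sigma\in\mathrm{Aut}(T_n):$ for all $m\ge0$ and words $x$ of length $m$, $P(\sigma,x)\equiv P(\sigma,x_0)\pmod{2^{\lfloor(n-m+1)/2\rfloor}}\}$. Basilica group: $\boldsymbol\alpha,\boldsymbol\beta\in\mathrm{Aut}(T_\infty)$ are defined by $\mathrm{Par}(\boldsymbol\alpha,b^k)=1$ for even $k\ge0$ ($b^k$ the word of $k$ letters $b$), $\mathrm{Par}(\boldsymbol\beta,b^k)=1$ for odd $k$, and $\mathrm{Par}=0$ at all other nodes for both. $B_\infty:=\langle\boldsymbol\alpha,\boldsymbol\beta\rangle$, $\overline{B}_\infty$ its closure, $B_n$ its image under restriction to $T_n$. -}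

module Defs where

open import Data.Bool using (Bool; true; false; _xor_; _∧_; if_then_else_)
open import Data.Nat using (ℕ; zero; suc; _+_; _*_; _∸_; _^_; _≤_; _<_; _%_; _/_)
open import Data.Nat.Properties using (m^n≢0)
open import Data.List using (List; []; _∷_; _++_; length)
open import Data.List.Membership.Propositional using (_∈_)
open import Data.List.Relation.Unary.Unique.Propositional using (Unique)
open import Data.Integer as ℤ using (ℤ; +_; _%ℕ_)
open import Data.Product using (Σ; ∃-syntax; _×_)
open import Function.Bundles using (_⇔_)
open import Relation.Binary.PropositionalEquality using (_≡_)

-- Words: letter a = false, letter b = true.  Root x₀ = [].

Word : Set
Word = List Bool

a b : Bool
a = false
b = true

-- Aut(T∞), represented by portraits: σ ↦ (x ↦ Par(σ,x)).
-- (Every automorphism is determined by its parities and every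
-- assignment of parities gives an automorphism.)

Aut∞ : Set
Aut∞ = Word → Bool

section : Aut∞ → Bool → Aut∞
section σ c w = σ (c ∷ w)

act : Aut∞ → Word → Word
act σ []      = []
act σ (c ∷ w) = (c xor σ []) ∷ act (section σ c) w

actInv : Aut∞ → Word → Word
actInv σ []      = []
actInv σ (c ∷ w) = (c xor σ []) ∷ actInv (section σ (c xor σ [])) w

idᵃ : Aut∞
idᵃ _ = false

_∘ᵃ_ : Aut∞ → Aut∞ → Aut∞
(σ ∘ᵃ τ) x = τ x xor σ (act τ x)

invᵃ : Aut∞ → Aut∞
invᵃ σ x = σ (actInv σ x)

-- 2-adic quantities.  A 2-adic integer is determined by its residues
-- mod 2^k for all k; Pmod σ x k := P(σ,x) mod 2^k ∈ {0,…,2^k-1}.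

modPow : ℕ → ℕ → ℕ
modPow u k = _%_ u (2 ^ k) {{m^n≢0 2 k}}

parℕ : Bool → ℕ
parℕ false = 0
parℕ true  = 1

S : Aut∞ → Word → ℕ → ℕ
S σ x zero    = parℕ (σ x)
S σ x (suc i) = S σ (x ++ (a ∷ a ∷ [])) i + S σ (x ++ (a ∷ b ∷ [])) i

-- truncation Σ_{i<k} 2^i S σ x i of the 2-adic series Q(σ,x)
Qtr : Aut∞ → Word → ℕ → ℕ
Qtr σ x zero    = 0
Qtr σ x (suc k) = Qtr σ x k + 2 ^ k * S σ x k

-- (-1)^{Par(σ,x)} + 2 Σ_t Q(σ,xbt) − 2 Σ_t Q(σ,xat), with Q truncated
-- at k terms (the omitted terms are ≡ 0 mod 2^k)
Pint : Aut∞ → Word → ℕ → ℤ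
Pint σ x k =
  (if σ x then ℤ.- (+ 1) else + 1)
  ℤ.+ (+ 2) ℤ.* (+ (Qtr σ (x ++ (b ∷ a ∷ [])) k + Qtr σ (x ++ (b ∷ b ∷ [])) k))
  ℤ.- (+ 2) ℤ.* (+ (Qtr σ (x ++ (a ∷ a ∷ [])) k + Qtr σ (x ++ (a ∷ b ∷ [])) k))

Pmod : Aut∞ → Word → ℕ → ℕ
Pmod σ x k = _%ℕ_ (Pint σ x k) (2 ^ k) {{m^n≢0 2 k}}

ℤ₂ : Set
ℤ₂ = ℕ → Bool

val : ℤ₂ → ℕ → ℕ
val u zero    = 0
val u (suc k) = val u k + 2 ^ k * parℕ (u k)

IsUnit₂ : ℤ₂ → Set
IsUnit₂ u = u 0 ≡ true

InM∞ : Aut∞ → Set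
InM∞ σ = ∀ (x : Word) (k : ℕ) → Pmod σ x k ≡ Pmod σ [] k

allB : Word → Bool
allB []          = true
allB (false ∷ w) = false
allB (true ∷ w)  = allB w

evenᵇ : ℕ → Bool
evenᵇ zero          = true
evenᵇ (suc zero)    = false
evenᵇ (suc (suc n)) = evenᵇ n

oddᵇ : ℕ → Bool
oddᵇ n = if evenᵇ n then false else true

𝛂 𝛃 : Aut∞
𝛂 w = allB w ∧ evenᵇ (length w)
𝛃 w = allB w ∧ oddᵇ (length w)

data Gen : Set where
  α⁺ α⁻ β⁺ β⁻ : Gen

gen : Gen → Aut∞
gen α⁺ = 𝛂
gen α⁻ = invᵃ 𝛂
gen β⁺ = 𝛃
gen β⁻ = invᵃ 𝛃

eval : List Gen → Aut∞
eval []       = idᵃ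
eval (g ∷ gs) = gen g ∘ᵃ eval gs

-- closure of B∞ in the profinite topology: every basic open
-- neighbourhood σ·Stab(m) (automorphisms acting as σ on all nodes of
-- length ≤ m) meets B∞
InClosureB : Aut∞ → Set
InClosureB σ = ∀ (m : ℕ) → ∃[ gs ] (∀ (w : Word) → length w ≤ m → act (eval gs) w ≡ act σ w)

-- Aut(T_n), represented by portraits of depth n (parities at nodes of
-- length < n); node p l r : root parity p, subtree below a, below b.

data Tree : ℕ → Set where
  leaf : Tree zero
  node : ∀ {n} → Bool → Tree n → Tree n → Tree (suc n)

ext : ∀ {n} → Tree n → Aut∞
ext leaf             w           = false
ext (node p l r)     []          = p
ext (node p l r)     (false ∷ w) = ext l w
ext (node p l r)     (true ∷ w)  = ext r w

restrict : (n : ℕ) → Aut∞ → Tree n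
restrict zero    σ = leaf
restrict (suc n) σ = node (σ []) (restrict n (section σ a)) (restrict n (section σ b))

_∘ₙ_ : ∀ {n} → Tree n → Tree n → Tree n
_∘ₙ_ {n} τ υ = restrict n (ext τ ∘ᵃ ext υ)

invₙ : ∀ {n} → Tree n → Tree n
invₙ {n} τ = restrict n (invᵃ (ext τ))

expo : ℕ → ℕ → ℕ
expo n m = (n + 1 ∸ m) / 2

InM : (n : ℕ) → Tree n → Set
InM n τ = ∀ (x : Word) → length x ≤ n →
  Pmod (ext τ) x (expo n (length x)) ≡ Pmod (ext τ) [] (expo n (length x))

InB : (n : ℕ) → Tree n → Set
InB n τ = ∃[ gs ] (restrict n (eval gs) ≡ τ)

jj : ℕ → ℕ
jj n = (n + 1) / 2

-- m_n = 2^{n+1}/3 + n − (5/3 if n even, 4/3 if n odd)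
--     = (2^{n+1} + 3n − (5 or 4)) / 3  (exact division)
mExp : ℕ → ℕ
mExp n = (2 ^ (n + 1) + 3 * n ∸ (if evenᵇ n then 5 else 4)) / 3

HasCard : {A : Set} → (A → Set) → ℕ → Set
HasCard {A} P k = Σ (List A) λ L → Unique L × (∀ x → (x ∈ L) ⇔ P x) × length L ≡ k

{-# OPTIONS --safe #-}

-- Set [a] = 0 and [b] = 1.  If P(σ, x) = p for all x, then the map z ↦ p z + Q(σ, x₀)
-- sends [c] to [σ(c)] + 2 Σₜ Q(σ, c t); hence σ ↦ (z ↦ P(σ) z + Q(σ)) is a homomorphism
-- from M∞ to the affine group of ℤ₂, and so is its linear part P.  At level n everything holds
-- modulo 2^⌈n/2⌉, with Q(σ, xa) + Q(σ, xb) known modulo 2^⌊n/2⌋.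
--
-- Given u = 1 + 2v, a tree with P = u at all nodes and with prescribed values of Q at the
-- root and of the sum of Q over its two children can be chosen level by level; the free
-- parameter at each step is the value of Q at the node a.  This yields both
-- surjectivity and the count.
--
-- On Bₙ, where P = 1, Q is the exponent of α and the sum of Q over the children is the
-- exponent of β.  Multiplying by α = swap · (1, β) reduces to τ = (x, y), and P(τ) = 1 says
-- that x and y have the same β-exponent.  By induction x and y are words in α and β, and
-- since Bₙ contains (α, 1), (1, α) and (β, β), it contains (x, β^k) and (β^m, y) with k ≡ m,
-- and hence (x, y).
module Submission where

open import Defs
open import Data.Bool using (Bool; true; false; not; if_then_else_; _xor_; _∧_)
open import Data.Integer using (ℤ; +_; -[1+_]; -_; _+_; _*_; _-_; _%ℕ_; _/ℕ_)
open import Data.Integer.DivMod using (a≡a%ℕn+[a/ℕn]*n; n%ℕd<d)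
import Data.Integer.Properties as ℤₚ
open import Data.Integer.Tactic.RingSolver using (solve-∀)
open import Data.List using ([]; _∷_; _++_; length; map; cartesianProductWith)
open import Data.List.Membership.Propositional using (_∈_)
open import Data.List.Membership.Propositional.Properties
  using (∈-++⁺ˡ; ∈-++⁺ʳ; ∈-++⁻; ∈-cartesianProductWith⁺; ∈-cartesianProductWith⁻)
open import Data.List.Properties using (length-++; length-map; ∷-injectiveˡ; ∷-injectiveʳ)
import Data.List.Relation.Unary.All as All
import Data.List.Relation.Unary.AllPairs as AllPairs
open import Data.List.Relation.Unary.Any using (here)
import Data.List.Relation.Unary.Unique.Propositional.Properties as Unique
open import Data.Nat using (ℕ; zero; suc; _≤_; _<_; _%_; _^_; z≤n; s≤s; ⌊_/2⌋; ⌈_/2⌉)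
import Data.Nat as ℕ
import Data.Nat.DivMod as ℕₚ
import Data.Nat.Properties as ℕₚ
import Data.Nat.Tactic.RingSolver as ℕ-Solver
open import Data.Product using (∃; _×_; _,_; proj₁; proj₂; ∃-syntax)
open import Data.Sum using (inj₁; inj₂)
open import Function.Bundles using (_⇔_; mk⇔; Equivalence)
open import Relation.Binary.Bundles using (Setoid)
open import Relation.Binary.PropositionalEquality

-- Congruences modulo 2^k

infix 4 _≈[_]_

-- As a record type it is injective in its arguments, so the exponent can be inferred; from the
-- number `2 ^ k` alone it could not be.
record _≈[_]_ (x : ℤ) (k : ℕ) (y : ℤ) : Set where
  constructor differBy
  field
    multiple : ℤ
    equation : x ≡ y + + (2 ^ k) * multiple

≈-reflexive : ∀ {k x y} → x ≡ y → x ≈[ k ] y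
≈-reflexive {k} {x} refl = differBy (+ 0) (lem x (+ (2 ^ k)))
  where
  lem : ∀ x m → x ≡ x + m * + 0
  lem = solve-∀

≈-refl : ∀ {k x} → x ≈[ k ] x
≈-refl = ≈-reflexive refl

≈-sym : ∀ {k x y} → x ≈[ k ] y → y ≈[ k ] x
≈-sym {k} {y = y} (differBy z eq) = differBy (- z)
  (trans (lem y (+ (2 ^ k)) z) (cong (λ x → x + + (2 ^ k) * - z) (sym eq)))
  where
  lem : ∀ y m z → y ≡ y + m * z + m * (- z)
  lem = solve-∀

≈-trans : ∀ {k x y z} → x ≈[ k ] y → y ≈[ k ] z → x ≈[ k ] z
≈-trans {k} {z = z} (differBy p refl) (differBy q refl) =
  differBy (p + q) (lem z (+ (2 ^ k)) p q)
  where
  lem : ∀ z m p q → z + m * q + m * p ≡ z + m * (p + q)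
  lem = solve-∀

≈-setoid : ℕ → Setoid _ _
≈-setoid k = record
  { Carrier = ℤ ; _≈_ = _≈[ k ]_
  ; isEquivalence = record { refl = ≈-refl ; sym = ≈-sym ; trans = ≈-trans } }

module ≈-Reasoning (k : ℕ) where
  open import Relation.Binary.Reasoning.Setoid (≈-setoid k) public

+-cong : ∀ {k x x′ y y′} → x ≈[ k ] x′ → y ≈[ k ] y′ → x + y ≈[ k ] x′ + y′
+-cong {k} {x′ = x} {y′ = y} (differBy p refl) (differBy q refl) =
  differBy (p + q) (lem x y (+ (2 ^ k)) p q)
  where
  lem : ∀ x y m p q → x + m * p + (y + m * q) ≡ x + y + m * (p + q)
  lem = solve-∀

*-cong : ∀ {k x x′ y y′} → x ≈[ k ] x′ → y ≈[ k ] y′ → x * y ≈[ k ] x′ * y′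
*-cong {k} {x′ = x} {y′ = y} (differBy p refl) (differBy q refl) =
  differBy (p * y + x * q + + (2 ^ k) * p * q) (lem x y (+ (2 ^ k)) p q)
  where
  lem : ∀ x y m p q →
    (x + m * p) * (y + m * q) ≡ x * y + m * (p * y + x * q + m * p * q)
  lem = solve-∀

+-congˡ : ∀ {k y y′} x → y ≈[ k ] y′ → x + y ≈[ k ] x + y′
+-congˡ x = +-cong (≈-refl {x = x})

+-congʳ : ∀ {k x x′} y → x ≈[ k ] x′ → x + y ≈[ k ] x′ + y
+-congʳ y x≈x′ = +-cong x≈x′ (≈-refl {x = y})

*-congˡ : ∀ {k y y′} x → y ≈[ k ] y′ → x * y ≈[ k ] x * y′
*-congˡ x = *-cong (≈-refl {x = x})

*-congʳ : ∀ {k x x′} y → x ≈[ k ] x′ → x * y ≈[ k ] x′ * y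
*-congʳ y x≈x′ = *-cong x≈x′ (≈-refl {x = y})

neg-cong : ∀ {k x x′} → x ≈[ k ] x′ → - x ≈[ k ] - x′
neg-cong {k} {x′ = x} (differBy p refl) = differBy (- p) (lem x (+ (2 ^ k)) p)
  where
  lem : ∀ x m p → - (x + m * p) ≡ - x + m * (- p)
  lem = solve-∀

pos-2^suc : ∀ k → + (2 ^ suc k) ≡ + 2 * + (2 ^ k)
pos-2^suc k = ℤₚ.pos-* 2 (2 ^ k)

double-cong : ∀ {k x y} → x ≈[ k ] y → + 2 * x ≈[ suc k ] + 2 * y
double-cong {k} {y = y} (differBy z refl) = differBy z
  (trans (lem y (+ (2 ^ k)) z) (cong (λ m → + 2 * y + m * z) (sym (pos-2^suc k))))
  where
  lem : ∀ y m z → + 2 * (y + m * z) ≡ + 2 * y + + 2 * m * z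
  lem = solve-∀

double-cancel : ∀ {k x y} → + 2 * x ≈[ suc k ] + 2 * y → x ≈[ k ] y
double-cancel {k} {x} {y} (differBy z eq) = differBy z
  (ℤₚ.*-cancelˡ-≡ (+ 2) x _ (trans eq
    (trans (cong (λ m → + 2 * y + m * z) (pos-2^suc k)) (lem y (+ (2 ^ k)) z))))
  where
  lem : ∀ y m z → + 2 * y + + 2 * m * z ≡ + 2 * (y + m * z)
  lem = solve-∀

≈-mod-1 : ∀ {x y} → x ≈[ 0 ] y
≈-mod-1 {x} {y} = differBy (x - y) (lem x y)
  where
  lem : ∀ x y → x ≡ y + + 1 * (x - y)
  lem = solve-∀

≈-pred : ∀ {k x y} → x ≈[ suc k ] y → x ≈[ k ] y
≈-pred {k} {y = y} (differBy z refl) = differBy (+ 2 * z)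
  (trans (cong (λ m → y + m * z) (pos-2^suc k)) (lem y (+ (2 ^ k)) z))
  where
  lem : ∀ y m z → y + + 2 * m * z ≡ y + m * (+ 2 * z)
  lem = solve-∀

≈-weaken : ∀ {j k x y} → j ≤ k → x ≈[ k ] y → x ≈[ j ] y
≈-weaken j≤k = go (ℕₚ.≤⇒≤′ j≤k)
  where
  go : ∀ {j k x y} → j ℕ.≤′ k → x ≈[ k ] y → x ≈[ j ] y
  go ℕ.≤′-refl       x≈y = x≈y
  go (ℕ.≤′-step j≤k) x≈y = go j≤k (≈-pred x≈y)

residue : ℤ → ℕ → ℕ
residue x k = _%ℕ_ x (2 ^ k) {{ℕₚ.m^n≢0 2 k}}

residue-< : ∀ x k → residue x k < 2 ^ k
residue-< x k = n%ℕd<d x (2 ^ k) {{ℕₚ.m^n≢0 2 k}}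

≈-residue : ∀ {k} x → x ≈[ k ] + residue x k
≈-residue {k} x = differBy q (trans (a≡a%ℕn+[a/ℕn]*n x (2 ^ k))
  (cong (λ y → + residue x k + y) (ℤₚ.*-comm q (+ (2 ^ k)))))
  where
  instance _ = ℕₚ.m^n≢0 2 k
  q = x /ℕ (2 ^ k)

<2^-unique : ∀ {k i j} → i < 2 ^ k → j < 2 ^ k → + i ≈[ k ] + j → i ≡ j
<2^-unique {k} {i} {j} i< j< i≈j = go i< j< i≈j
  where
  instance _ = ℕₚ.m^n≢0 2 k
  pos : ∀ {i j} n → i < 2 ^ k → j < 2 ^ k →
        + i ≡ + j + + (2 ^ k) * + n → i ≡ j
  pos {i} {j} n i< j< eq = begin
    i                          ≡⟨ ℕₚ.m<n⇒m%n≡m i< ⟨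
    i % 2 ^ k                  ≡⟨ cong (_% 2 ^ k) (ℤₚ.+-injective eq′) ⟩
    (j ℕ.+ n ℕ.* 2 ^ k) % 2 ^ k ≡⟨ ℕₚ.[m+kn]%n≡m%n j n (2 ^ k) ⟩
    j % 2 ^ k                  ≡⟨ ℕₚ.m<n⇒m%n≡m j< ⟩
    j                          ∎
    where
    open ≡-Reasoning
    eq′ : + i ≡ + (j ℕ.+ n ℕ.* 2 ^ k)
    eq′ = trans eq (cong (λ m → + j + m)
      (trans (ℤₚ.*-comm (+ (2 ^ k)) (+ n)) (sym (ℤₚ.pos-* n (2 ^ k)))))
  go : ∀ {i j} → i < 2 ^ k → j < 2 ^ k → + i ≈[ k ] + j → i ≡ j
  go i< j< (differBy (+ n) eq) = pos n i< j< eq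
  -- Reversing the congruence negates the multiple and makes it positive.
  go i< j< i≈j@(differBy -[1+ n ] eq) =
    sym (pos (suc n) j< i< (_≈[_]_.equation (≈-sym i≈j)))

residue-cong : ∀ {k x y} → x ≈[ k ] y → residue x k ≡ residue y k
residue-cong {k} {x} {y} x≈y = <2^-unique (residue-< x k) (residue-< y k)
  (≈-trans (≈-sym (≈-residue x)) (≈-trans x≈y (≈-residue y)))

residue-injective : ∀ {k x y} → residue x k ≡ residue y k → x ≈[ k ] y
residue-injective {k} {x} {y} eq =
  ≈-trans (≈-residue x) (≈-trans (≈-reflexive (cong +_ eq)) (≈-sym (≈-residue y)))

-- The group of finite trees and the cocycle identity for Q and P

infixl 7 _·_

-- The structurally recursive form of `_∘ₙ_`. The right factor acts first, so if it swaps at the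
-- root, its left subtree meets the right subtree of the other factor.
_·_ : ∀ {n} → Tree n → Tree n → Tree n
leaf       · leaf           = leaf
node c l r · node false x y = node c (l · x) (r · y)
node c l r · node true x y  = node (not c) (r · x) (l · y)

1ₜ : ∀ {n} → Tree n
1ₜ {zero}  = leaf
1ₜ {suc n} = node false 1ₜ 1ₜ

inv : ∀ {n} → Tree n → Tree n
inv leaf             = leaf
inv (node false l r) = node false (inv l) (inv r)
inv (node true l r)  = node true (inv r) (inv l)

·-identityˡ : ∀ {n} (τ : Tree n) → 1ₜ · τ ≡ τ
·-identityˡ leaf             = refl
·-identityˡ (node false l r) = cong₂ (node false) (·-identityˡ l) (·-identityˡ r)
·-identityˡ (node true l r)  = cong₂ (node true) (·-identityˡ l) (·-identityˡ r)

·-identityʳ : ∀ {n} (τ : Tree n) → τ · 1ₜ ≡ τ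
·-identityʳ leaf         = refl
·-identityʳ (node c l r) = cong₂ (node c) (·-identityʳ l) (·-identityʳ r)

·-assoc : ∀ {n} (ρ σ τ : Tree n) → (ρ · σ) · τ ≡ ρ · (σ · τ)
·-assoc leaf leaf leaf = refl
·-assoc (node c l r) (node false x y) (node false u v) =
  cong₂ (node c) (·-assoc l x u) (·-assoc r y v)
·-assoc (node c l r) (node false x y) (node true u v) =
  cong₂ (node (not c)) (·-assoc r y u) (·-assoc l x v)
·-assoc (node c l r) (node true x y) (node false u v) =
  cong₂ (node (not c)) (·-assoc r x u) (·-assoc l y v)
·-assoc (node false l r) (node true x y) (node true u v) =
  cong₂ (node false) (·-assoc l y u) (·-assoc r x v)
·-assoc (node true l r) (node true x y) (node true u v) =
  cong₂ (node true) (·-assoc l y u) (·-assoc r x v)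

·-inverseʳ : ∀ {n} (τ : Tree n) → τ · inv τ ≡ 1ₜ
·-inverseʳ leaf             = refl
·-inverseʳ (node false l r) = cong₂ (node false) (·-inverseʳ l) (·-inverseʳ r)
·-inverseʳ (node true l r)  = cong₂ (node false) (·-inverseʳ r) (·-inverseʳ l)

par sgn : Bool → ℤ
par c = + parℕ c
sgn c = if c then - (+ 1) else + 1

-- One step of the series for Q descends two levels, through the letter a and then through either
-- letter. `Qₛ`, the sum of Q over the two children, splits this into two steps of one level each.
Q Qₛ : ∀ {n} → Tree n → ℤ
Q leaf          = + 0
Q (node c l r)  = par c + + 2 * Qₛ l
Qₛ leaf         = + 0
Qₛ (node c l r) = Q l + Q r

P : ∀ {n} → Tree n → ℤ
P leaf         = + 1
P (node c l r) = sgn c + + 2 * Qₛ r - + 2 * Qₛ l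

-- A subtree of height h rooted at level m of Tₙ has h = n − m, so ⌈h/2⌉ is the exponent
-- ⌊(n − m + 1)/2⌋ in the definition of Mₙ.
data HasP (p : ℤ) : ∀ {n} → Tree n → Set where
  leaf : HasP p leaf
  node : ∀ {n c} {l r : Tree n} → P (node c l r) ≈[ ⌈ suc n /2⌉ ] p →
         HasP p l → HasP p r → HasP p (node c l r)

sgn≡1-2par : ∀ c → sgn c ≡ + 1 - + 2 * par c
sgn≡1-2par false = refl
sgn≡1-2par true  = refl

par-not : ∀ c → par (not c) ≡ + 1 - par c
par-not false = refl
par-not true  = refl

-- Mutual induction with `Qₛ-·`; the factor 2 supplies the additional bit of precision, as
-- `⌈ suc n /2⌉` is `suc ⌊ n /2⌋`. If τ swaps at the root, the product sees r where Q σ sees l. The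
-- discrepancy is exactly `P (node c l r)`, which is p, and p is what the root parity 1 of τ has to
-- contribute.
Q-· : ∀ {n p} {σ : Tree n} → HasP p σ → ∀ τ →
      Q (σ · τ) ≈[ ⌈ n /2⌉ ] Q σ + p * Q τ
Qₛ-· : ∀ {n p} {σ : Tree n} → HasP p σ → ∀ τ →
       Qₛ (σ · τ) ≈[ ⌊ n /2⌋ ] Qₛ σ + p * Qₛ τ

Q-· leaf leaf = ≈-mod-1
Q-· {suc n} {p} (node {c = c} {l} {r} P≈p σl σr) (node false x y) = begin
  par c + + 2 * Qₛ (l · x)        ≈⟨ +-congˡ (par c) (double-cong (Qₛ-· σl x)) ⟩
  par c + + 2 * (Qₛ l + p * Qₛ x) ≡⟨ lem (par c) (Qₛ l) p (Qₛ x) ⟩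
  par c + + 2 * Qₛ l + p * (+ 0 + + 2 * Qₛ x) ∎
  where
  open ≈-Reasoning ⌈ suc n /2⌉
  lem : ∀ c l p x → c + + 2 * (l + p * x) ≡ c + + 2 * l + p * (+ 0 + + 2 * x)
  lem = solve-∀
Q-· {suc n} {p} (node {c = c} {l} {r} P≈p σl σr) (node true x y) = begin
  par (not c) + + 2 * Qₛ (r · x)
    ≈⟨ +-cong (≈-reflexive (par-not c)) (double-cong (Qₛ-· σr x)) ⟩
  + 1 - par c + + 2 * (Qₛ r + p * Qₛ x)
    ≡⟨ lem₁ (par c) (Qₛ l) (Qₛ r) p (Qₛ x) ⟩
  par c + + 2 * Qₛ l + (+ 1 - + 2 * par c + + 2 * Qₛ r - + 2 * Qₛ l + p * (+ 2 * Qₛ x))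
    ≡⟨ cong (λ s → par c + + 2 * Qₛ l + (s + + 2 * Qₛ r - + 2 * Qₛ l + p * (+ 2 * Qₛ x)))
         (sgn≡1-2par c) ⟨
  par c + + 2 * Qₛ l + (P (node c l r) + p * (+ 2 * Qₛ x))
    ≈⟨ +-congˡ (par c + + 2 * Qₛ l) (+-congʳ (p * (+ 2 * Qₛ x)) P≈p) ⟩
  par c + + 2 * Qₛ l + (p + p * (+ 2 * Qₛ x))
    ≡⟨ cong (λ z → par c + + 2 * Qₛ l + z) (lem₂ p (Qₛ x)) ⟩
  par c + + 2 * Qₛ l + p * (+ 1 + + 2 * Qₛ x) ∎
  where
  open ≈-Reasoning ⌈ suc n /2⌉
  lem₁ : ∀ c l r p x → + 1 - c + + 2 * (r + p * x) ≡
         c + + 2 * l + (+ 1 - + 2 * c + + 2 * r - + 2 * l + p * (+ 2 * x))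
  lem₁ = solve-∀
  lem₂ : ∀ p x → p + p * (+ 2 * x) ≡ p * (+ 1 + + 2 * x)
  lem₂ = solve-∀

Qₛ-· leaf leaf = ≈-mod-1
Qₛ-· {suc n} {p} (node {c = c} {l} {r} P≈p σl σr) (node false x y) =
  ≈-trans (+-cong (Q-· σl x) (Q-· σr y)) (≈-reflexive (lem (Q l) (Q r) p (Q x) (Q y)))
  where
  lem : ∀ l r p x y → l + p * x + (r + p * y) ≡ l + r + p * (x + y)
  lem = solve-∀
Qₛ-· {suc n} {p} (node {c = c} {l} {r} P≈p σl σr) (node true x y) =
  ≈-trans (+-cong (Q-· σr x) (Q-· σl y)) (≈-reflexive (lem (Q l) (Q r) p (Q x) (Q y)))
  where
  lem : ∀ l r p x y → r + p * x + (l + p * y) ≡ l + r + p * (x + y)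
  lem = solve-∀

-- `Qₛ-·` at both children separates the contribution of σ from p times that of τ. The contribution
-- of σ is P σ, or its negative when τ swaps at the root; this matches the sign in P τ.
P-· : ∀ {n p} {σ : Tree n} → HasP p σ → ∀ τ → P (σ · τ) ≈[ ⌈ n /2⌉ ] p * P τ
P-· leaf leaf = ≈-mod-1
P-· {suc n} {p} (node {c = c} {l} {r} P≈p σl σr) (node false x y) = begin
  sgn c + + 2 * Qₛ (r · y) - + 2 * Qₛ (l · x)
    ≈⟨ +-cong (+-congˡ (sgn c) (double-cong (Qₛ-· σr y))) (neg-cong (double-cong (Qₛ-· σl x))) ⟩
  sgn c + + 2 * (Qₛ r + p * Qₛ y) - + 2 * (Qₛ l + p * Qₛ x)
    ≡⟨ lem₁ (sgn c) (Qₛ l) (Qₛ r) p (Qₛ x) (Qₛ y) ⟩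
  P (node c l r) + p * (+ 2 * Qₛ y - + 2 * Qₛ x)
    ≈⟨ +-congʳ (p * (+ 2 * Qₛ y - + 2 * Qₛ x)) P≈p ⟩
  p + p * (+ 2 * Qₛ y - + 2 * Qₛ x)
    ≡⟨ lem₂ p (Qₛ x) (Qₛ y) ⟩
  p * (+ 1 + + 2 * Qₛ y - + 2 * Qₛ x) ∎
  where
  open ≈-Reasoning ⌈ suc n /2⌉
  lem₁ : ∀ s l r p x y → s + + 2 * (r + p * y) - + 2 * (l + p * x) ≡
         s + + 2 * r - + 2 * l + p * (+ 2 * y - + 2 * x)
  lem₁ = solve-∀
  lem₂ : ∀ p x y → p + p * (+ 2 * y - + 2 * x) ≡ p * (+ 1 + + 2 * y - + 2 * x)
  lem₂ = solve-∀
P-· {suc n} {p} (node {c = c} {l} {r} P≈p σl σr) (node true x y) = begin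
  sgn (not c) + + 2 * Qₛ (l · y) - + 2 * Qₛ (r · x)
    ≈⟨ +-cong (+-cong (≈-reflexive (sgn-not c)) (double-cong (Qₛ-· σl y)))
              (neg-cong (double-cong (Qₛ-· σr x))) ⟩
  - sgn c + + 2 * (Qₛ l + p * Qₛ y) - + 2 * (Qₛ r + p * Qₛ x)
    ≡⟨ lem₁ (sgn c) (Qₛ l) (Qₛ r) p (Qₛ x) (Qₛ y) ⟩
  - P (node c l r) + p * (+ 2 * Qₛ y - + 2 * Qₛ x)
    ≈⟨ +-congʳ (p * (+ 2 * Qₛ y - + 2 * Qₛ x)) (neg-cong P≈p) ⟩
  - p + p * (+ 2 * Qₛ y - + 2 * Qₛ x)
    ≡⟨ lem₂ p (Qₛ x) (Qₛ y) ⟩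
  p * (- (+ 1) + + 2 * Qₛ y - + 2 * Qₛ x) ∎
  where
  open ≈-Reasoning ⌈ suc n /2⌉
  sgn-not : ∀ c → sgn (not c) ≡ - sgn c
  sgn-not false = refl
  sgn-not true  = refl
  lem₁ : ∀ s l r p x y → - s + + 2 * (l + p * y) - + 2 * (r + p * x) ≡
         - (s + + 2 * r - + 2 * l) + p * (+ 2 * y - + 2 * x)
  lem₁ = solve-∀
  lem₂ : ∀ p x y → - p + p * (+ 2 * y - + 2 * x) ≡ p * (- (+ 1) + + 2 * y - + 2 * x)
  lem₂ = solve-∀

HasP-· : ∀ {n p q} {σ τ : Tree n} → HasP p σ → HasP q τ → HasP (p * q) (σ · τ)
HasP-· leaf leaf = leaf
HasP-· {p = p} σ@(node _ σl σr) (node {c = false} {x} {y} P≈q τx τy) =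
  node (≈-trans (P-· σ (node false x y)) (*-congˡ p P≈q)) (HasP-· σl τx) (HasP-· σr τy)
HasP-· {p = p} σ@(node _ σl σr) (node {c = true} {x} {y} P≈q τx τy) =
  node (≈-trans (P-· σ (node true x y)) (*-congˡ p P≈q)) (HasP-· σr τx) (HasP-· σl τy)

P-1ₜ : ∀ {n} → P (1ₜ {n}) ≡ + 1
P-1ₜ {zero}  = refl
P-1ₜ {suc n} = lem (Qₛ (1ₜ {n}))
  where
  lem : ∀ x → + 1 + + 2 * x - + 2 * x ≡ + 1
  lem = solve-∀

⌈n/2⌉-mono-suc : ∀ n → ⌈ n /2⌉ ≤ ⌈ suc n /2⌉
⌈n/2⌉-mono-suc n = ℕₚ.⌈n/2⌉-mono (ℕₚ.n≤1+n n)

P-inv : ∀ {n p} {τ : Tree n} → HasP p τ → p * P (inv τ) ≈[ ⌈ n /2⌉ ] + 1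
P-inv {n} {τ = τ} hp = ≈-trans (≈-sym (P-· hp (inv τ)))
  (≈-reflexive (trans (cong P (·-inverseʳ τ)) (P-1ₜ {n})))

-- A single integer q serves at every node, because it remains an inverse of p modulo the smaller
-- powers of 2 met further down.
HasP-inv : ∀ {n p q} {τ : Tree n} → p * q ≈[ ⌈ n /2⌉ ] + 1 → HasP p τ → HasP q (inv τ)
HasP-inv pq≈1 leaf = leaf
HasP-inv {suc n} {p} {q} {τ} pq≈1 hp@(node {c = c} {l} {r} _ hl hr) = go c refl
  where
  open ≈-Reasoning ⌈ suc n /2⌉
  lem : ∀ p q x → p * q * x ≡ q * (p * x)
  lem = solve-∀
  P≈q : P (inv τ) ≈[ ⌈ suc n /2⌉ ] q
  P≈q = begin
    P (inv τ)           ≡⟨ ℤₚ.*-identityˡ _ ⟨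
    + 1 * P (inv τ)     ≈⟨ *-congʳ (P (inv τ)) pq≈1 ⟨
    p * q * P (inv τ)   ≡⟨ lem p q (P (inv τ)) ⟩
    q * (p * P (inv τ)) ≈⟨ *-congˡ q (P-inv hp) ⟩
    q * + 1             ≡⟨ ℤₚ.*-identityʳ q ⟩
    q                   ∎
  pq≈1′ : p * q ≈[ ⌈ n /2⌉ ] + 1
  pq≈1′ = ≈-weaken (⌈n/2⌉-mono-suc n) pq≈1
  -- `inv` reduces only when the root parity is known, so the cases are split after `P≈q` has been
  -- proved uniformly.
  go : ∀ c′ → c ≡ c′ → HasP q (inv τ)
  go false refl = node P≈q (HasP-inv pq≈1′ hl) (HasP-inv pq≈1′ hr)
  go true  refl = node P≈q (HasP-inv pq≈1′ hr) (HasP-inv pq≈1′ hl)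

HasP-P : ∀ {n p} {τ : Tree n} → HasP p τ → P τ ≈[ ⌈ n /2⌉ ] p
HasP-P leaf           = ≈-mod-1
HasP-P (node P≈p _ _) = P≈p

HasP-resp : ∀ {n p q} {τ : Tree n} → p ≈[ ⌈ n /2⌉ ] q → HasP p τ → HasP q τ
HasP-resp p≈q leaf = leaf
HasP-resp {suc n} p≈q (node P≈p l r) = node (≈-trans P≈p p≈q) (HasP-resp p≈q′ l) (HasP-resp p≈q′ r)
  where p≈q′ = ≈-weaken (⌈n/2⌉-mono-suc n) p≈q

-- Comparison with the residues Pmod

jj≡⌈n/2⌉ : ∀ n → jj n ≡ ⌈ n /2⌉
jj≡⌈n/2⌉ n = trans (cong (ℕ._/ 2) (ℕₚ.+-comm n 1)) (n/2≡⌊n/2⌋ (suc n))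
  where
  n/2≡⌊n/2⌋ : ∀ n → n ℕ./ 2 ≡ ⌊ n /2⌋
  n/2≡⌊n/2⌋ zero          = refl
  n/2≡⌊n/2⌋ (suc zero)    = refl
  n/2≡⌊n/2⌋ (suc (suc n)) =
    trans (ℕₚ.m/n≡1+[m∸n]/n {suc (suc n)} {2} (s≤s (s≤s z≤n))) (cong suc (n/2≡⌊n/2⌋ n))

S-section : ∀ σ c x i → S σ (c ∷ x) i ≡ S (section σ c) x i
S-section σ c x zero    = refl
S-section σ c x (suc i) = cong₂ ℕ._+_ (S-section σ c _ i) (S-section σ c _ i)

Qtr-section : ∀ σ c x k → Qtr σ (c ∷ x) k ≡ Qtr (section σ c) x k
Qtr-section σ c x zero    = refl
Qtr-section σ c x (suc k) =
  cong₂ ℕ._+_ (Qtr-section σ c x k) (cong (2 ^ k ℕ.*_) (S-section σ c x k))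

Qtr-section₂ : ∀ σ c d k → Qtr σ (c ∷ d ∷ []) k ≡ Qtr (section (section σ c) d) [] k
Qtr-section₂ σ c d k = trans (Qtr-section σ c (d ∷ []) k) (Qtr-section (section σ c) d [] k)

Pint-section : ∀ σ c x k → Pint σ (c ∷ x) k ≡ Pint (section σ c) x k
Pint-section σ c x k
  rewrite Qtr-section σ c (x ++ b ∷ a ∷ []) k | Qtr-section σ c (x ++ b ∷ b ∷ []) k
        | Qtr-section σ c (x ++ a ∷ a ∷ []) k | Qtr-section σ c (x ++ a ∷ b ∷ []) k = refl

-- `Qtr` is defined by appending the last term. Splitting off the first one instead gives the
-- recursion from the root that `Q` follows.
Qtr-suc : ∀ σ k → let σₐ = section σ a in
  Qtr σ [] (suc k) ≡
  parℕ (σ []) ℕ.+ 2 ℕ.* (Qtr (section σₐ a) [] k ℕ.+ Qtr (section σₐ b) [] k)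
Qtr-suc σ zero    = ℕ-lem (parℕ (σ []))
  where
  ℕ-lem : ∀ p → 0 ℕ.+ 1 ℕ.* p ≡ p ℕ.+ 2 ℕ.* (0 ℕ.+ 0)
  ℕ-lem = ℕ-Solver.solve-∀
Qtr-suc σ (suc k)
  rewrite Qtr-suc σ k
        | trans (S-section σ a (a ∷ []) k) (S-section (section σ a) a [] k)
        | trans (S-section σ a (b ∷ []) k) (S-section (section σ a) b [] k) =
  ℕ-lem (parℕ (σ [])) (2 ^ k) (Qtr (section (section σ a) a) [] k)
    (Qtr (section (section σ a) b) [] k) _ _
  where
  ℕ-lem : ∀ p m q₁ q₂ s₁ s₂ →
    p ℕ.+ 2 ℕ.* (q₁ ℕ.+ q₂) ℕ.+ (2 ℕ.* m) ℕ.* (s₁ ℕ.+ s₂) ≡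
    p ℕ.+ 2 ℕ.* ((q₁ ℕ.+ m ℕ.* s₁) ℕ.+ (q₂ ℕ.+ m ℕ.* s₂))
  ℕ-lem = ℕ-Solver.solve-∀

-- A true equality: the nodes that enter the series have even depth, and those of depth below n make
-- up exactly its first `⌈ n /2⌉` terms.
Q-restrict : ∀ n σ → Q (restrict n σ) ≡ + Qtr σ [] ⌈ n /2⌉
Q-restrict zero          σ = refl
Q-restrict (suc zero)    σ = cong +_ (sym (Qtr-suc σ 0))
Q-restrict (suc (suc n)) σ = begin
  par (σ []) + + 2 * (Q (restrict n σaa) + Q (restrict n σab))
    ≡⟨ cong₂ (λ x y → par (σ []) + + 2 * (x + y)) (Q-restrict n σaa) (Q-restrict n σab) ⟩
  par (σ []) + + 2 * (+ (q₁ ℕ.+ q₂))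
    ≡⟨ cong (λ x → par (σ []) + x) (ℤₚ.pos-* 2 (q₁ ℕ.+ q₂)) ⟨
  + (parℕ (σ []) ℕ.+ 2 ℕ.* (q₁ ℕ.+ q₂))
    ≡⟨ cong +_ (Qtr-suc σ ⌈ n /2⌉) ⟨
  + Qtr σ [] (suc ⌈ n /2⌉) ∎
  where
  open ≡-Reasoning
  σaa = section (section σ a) a
  σab = section (section σ a) b
  q₁ = Qtr σaa [] ⌈ n /2⌉
  q₂ = Qtr σab [] ⌈ n /2⌉

Qtr-truncate : ∀ {j k} σ x → j ≤ k → + Qtr σ x k ≈[ j ] + Qtr σ x j
Qtr-truncate σ x j≤k = go (ℕₚ.≤⇒≤′ j≤k)
  where
  go : ∀ {j k} → j ℕ.≤′ k → + Qtr σ x k ≈[ j ] + Qtr σ x j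
  go ℕ.≤′-refl = ≈-refl
  go {j} {suc k} (ℕ.≤′-step j≤k) = ≈-trans
    (≈-weaken (ℕₚ.≤′⇒≤ j≤k) (differBy (+ S σ x k)
      (cong (λ y → + Qtr σ x k + y) (ℤₚ.pos-* (2 ^ k) (S σ x k)))))
    (go j≤k)

Pint-truncate : ∀ {j k} σ x → j ≤ k → Pint σ x k ≈[ j ] Pint σ x j
Pint-truncate σ x j≤k =
  +-cong (+-congˡ (sgn (σ x)) (*-congˡ (+ 2) (+-cong (Qtr-truncate σ _ j≤k) (Qtr-truncate σ _ j≤k))))
         (neg-cong (*-congˡ (+ 2) (+-cong (Qtr-truncate σ _ j≤k) (Qtr-truncate σ _ j≤k))))

-- The truncation is one longer than the precision because `Pint` at exponent `⌈ suc n /2⌉` cuts its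
-- series after `suc ⌊ n /2⌋` terms; the factor 2 in front of them restores the missing bit.
Qₛ-restrict : ∀ n σ → let k = suc ⌊ n /2⌋ in
  Qₛ (restrict n σ) ≈[ ⌊ n /2⌋ ] + (Qtr (section σ a) [] k ℕ.+ Qtr (section σ b) [] k)
Qₛ-restrict zero    σ = ≈-mod-1
Qₛ-restrict (suc n) σ = +-cong (half (section σ a)) (half (section σ b))
  where
  half : ∀ σ → Q (restrict n σ) ≈[ ⌈ n /2⌉ ] + Qtr σ [] (suc ⌈ n /2⌉)
  half σ = ≈-trans (≈-reflexive (Q-restrict n σ)) (≈-sym (Qtr-truncate σ [] (ℕₚ.n≤1+n _)))

P-restrict : ∀ n σ → P (restrict n σ) ≈[ ⌈ n /2⌉ ] Pint σ [] ⌈ n /2⌉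
P-restrict zero    σ = ≈-mod-1
P-restrict (suc n) σ
  rewrite Qtr-section₂ σ b a (suc ⌊ n /2⌋) | Qtr-section₂ σ b b (suc ⌊ n /2⌋)
        | Qtr-section₂ σ a a (suc ⌊ n /2⌋) | Qtr-section₂ σ a b (suc ⌊ n /2⌋) =
  +-cong (+-congˡ (sgn (σ [])) (double-cong (Qₛ-restrict n (section σ b))))
         (neg-cong (double-cong (Qₛ-restrict n (section σ a))))

-- Here the common value p is given from outside and not read off at the root, so that the condition
-- passes to the sections of σ.
PintConst : ℤ → ℕ → Aut∞ → Set
PintConst p n σ = ∀ x → length x ≤ n →
  Pint σ x (expo n (length x)) ≈[ expo n (length x) ] p

P-restrict-jj : ∀ n σ → P (restrict n σ) ≈[ jj n ] Pint σ [] (jj n)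
P-restrict-jj n σ = subst (λ k → P (restrict n σ) ≈[ k ] Pint σ [] k)
  (sym (jj≡⌈n/2⌉ n)) (P-restrict n σ)

PintConst⇒HasP : ∀ n {p σ} → PintConst p n σ → HasP p (restrict n σ)
PintConst⇒HasP zero    h = leaf
PintConst⇒HasP (suc n) {p} {σ} h = node
  (subst (λ k → P (restrict (suc n) σ) ≈[ k ] p) (jj≡⌈n/2⌉ (suc n))
    (≈-trans (P-restrict-jj (suc n) σ) (h [] z≤n)))
  (PintConst⇒HasP n (child a)) (PintConst⇒HasP n (child b))
  where
  child : ∀ c → PintConst p n (section σ c)
  child c x x≤n = ≈-trans (≈-reflexive (sym (Pint-section σ c x (expo n (length x))))) (h (c ∷ x) (s≤s x≤n))

HasP⇒PintConst : ∀ n {p σ} → HasP p (restrict n σ) → PintConst p n σ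
HasP⇒PintConst n {p} {σ} h [] _ = ≈-trans (≈-sym (P-restrict-jj n σ))
  (subst (λ k → P (restrict n σ) ≈[ k ] p) (sym (jj≡⌈n/2⌉ n)) (HasP-P h))
HasP⇒PintConst (suc n) {p} {σ} (node _ l r) (false ∷ x) (s≤s x≤n) =
  ≈-trans (≈-reflexive (Pint-section σ a x (expo n (length x)))) (HasP⇒PintConst n l x x≤n)
HasP⇒PintConst (suc n) {p} {σ} (node _ l r) (true ∷ x) (s≤s x≤n) =
  ≈-trans (≈-reflexive (Pint-section σ b x (expo n (length x)))) (HasP⇒PintConst n r x x≤n)

-- Restriction to finite level and the group operations

restrict-cong : ∀ n {σ τ : Aut∞} → (∀ w → length w < n → σ w ≡ τ w) →
                restrict n σ ≡ restrict n τ
restrict-cong zero    h = refl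
restrict-cong (suc n) {σ} {τ} h rewrite h [] (s≤s z≤n) = cong₂ (node (τ []))
  (restrict-cong n (λ w w<n → h (a ∷ w) (s≤s w<n)))
  (restrict-cong n (λ w w<n → h (b ∷ w) (s≤s w<n)))

restrict-ext : ∀ {n} (τ : Tree n) → restrict n (ext τ) ≡ τ
restrict-ext leaf         = refl
restrict-ext (node c l r) = cong₂ (node c) (restrict-ext l) (restrict-ext r)

restrict-id : ∀ n → restrict n idᵃ ≡ 1ₜ
restrict-id zero    = refl
restrict-id (suc n) = cong₂ (node false) (restrict-id n) (restrict-id n)

restrict-∘ : ∀ n σ τ → restrict n (σ ∘ᵃ τ) ≡ restrict n σ · restrict n τ
restrict-∘ zero    σ τ = refl
restrict-∘ (suc n) σ τ with τ []
... | false = cong₂ (node (σ [])) (restrict-∘ n (section σ a) (section τ a))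
                                  (restrict-∘ n (section σ b) (section τ b))
... | true  = cong₂ (node (not (σ []))) (restrict-∘ n (section σ b) (section τ a))
                                        (restrict-∘ n (section σ a) (section τ b))

restrict-inv : ∀ n σ → restrict n (invᵃ σ) ≡ inv (restrict n σ)
restrict-inv zero    σ = refl
restrict-inv (suc n) σ with σ []
... | false = cong₂ (node false) (restrict-inv n (section σ a)) (restrict-inv n (section σ b))
... | true  = cong₂ (node true) (restrict-inv n (section σ b)) (restrict-inv n (section σ a))

∘ₙ≡· : ∀ {n} (σ τ : Tree n) → σ ∘ₙ τ ≡ σ · τ
∘ₙ≡· {n} σ τ = trans (restrict-∘ n (ext σ) (ext τ)) (cong₂ _·_ (restrict-ext σ) (restrict-ext τ))

invₙ≡inv : ∀ {n} (τ : Tree n) → invₙ τ ≡ inv τ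
invₙ≡inv {n} τ = trans (restrict-inv n (ext τ)) (cong inv (restrict-ext τ))

-- `InM n τ` is `InMₙ n (ext τ)`, and `InM∞` amounts to `InMₙ` for all n; both are thus translated
-- into `HasP` at once.
InMₙ : ℕ → Aut∞ → Set
InMₙ n σ = ∀ x → length x ≤ n →
  Pmod σ x (expo n (length x)) ≡ Pmod σ [] (expo n (length x))

expo≤jj : ∀ n m → expo n m ≤ jj n
expo≤jj n m = ℕₚ./-monoˡ-≤ 2 (ℕₚ.m∸n≤m (n ℕ.+ 1) m)

-- At level m + 2k a node of length m carries exactly k bits of P. This reduces statements about P
-- modulo 2^k on the infinite tree to a finite level.
expo-[m+2k]-m : ∀ m k → expo (m ℕ.+ 2 ℕ.* k) m ≡ k
expo-[m+2k]-m m k = begin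
  expo (m ℕ.+ 2 ℕ.* k) m ≡⟨ cong (λ n → (n ℕ.∸ m) ℕ./ 2) (ℕₚ.+-assoc m (2 ℕ.* k) 1) ⟩
  (m ℕ.+ (2 ℕ.* k ℕ.+ 1) ℕ.∸ m) ℕ./ 2 ≡⟨ cong (ℕ._/ 2) (ℕₚ.m+n∸m≡n m (2 ℕ.* k ℕ.+ 1)) ⟩
  jj (2 ℕ.* k)      ≡⟨ jj≡⌈n/2⌉ (2 ℕ.* k) ⟩
  ⌈ 2 ℕ.* k /2⌉     ≡⟨ cong (λ n → ⌈ k ℕ.+ n /2⌉) (ℕₚ.+-identityʳ k) ⟩
  ⌈ k ℕ.+ k /2⌉     ≡⟨ ℕₚ.n≡⌈n+n/2⌉ k ⟨
  k                 ∎
  where open ≡-Reasoning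

module _ (n : ℕ) (σ : Aut∞) where

  private
    P≈Pint : ∀ m → P (restrict n σ) ≈[ expo n m ] Pint σ [] (expo n m)
    P≈Pint m = ≈-trans (≈-weaken (expo≤jj n m) (P-restrict-jj n σ))
                       (Pint-truncate σ [] (expo≤jj n m))

  InMₙ⇒HasP : InMₙ n σ → HasP (P (restrict n σ)) (restrict n σ)
  InMₙ⇒HasP h = PintConst⇒HasP n λ x x≤n →
    ≈-trans (residue-injective (h x x≤n)) (≈-sym (P≈Pint (length x)))

  HasP⇒InMₙ : ∀ {p} → HasP p (restrict n σ) → InMₙ n σ
  HasP⇒InMₙ {p} h x x≤n = residue-cong
    (≈-trans (HasP⇒PintConst n h x x≤n) (≈-trans (≈-sym p≈P) (P≈Pint (length x))))
    where
    p≈P : P (restrict n σ) ≈[ expo n (length x) ] p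
    p≈P = ≈-weaken (expo≤jj n (length x))
      (subst (λ k → P (restrict n σ) ≈[ k ] p) (sym (jj≡⌈n/2⌉ n)) (HasP-P h))

InM∞⇒HasP : ∀ {σ} → InM∞ σ → ∀ n → HasP (P (restrict n σ)) (restrict n σ)
InM∞⇒HasP {σ} h n = InMₙ⇒HasP n σ (λ x _ → h x (expo n (length x)))

-- The value may vary with n: integer approximations stand in for a 2-adic number.
HasP⇒InM∞ : ∀ {σ} {p : ℕ → ℤ} → (∀ n → HasP (p n) (restrict n σ)) → InM∞ σ
HasP⇒InM∞ {σ} h x k = subst (λ i → Pmod σ x i ≡ Pmod σ [] i) (expo-[m+2k]-m m k)
  (HasP⇒InMₙ (m ℕ.+ 2 ℕ.* k) σ (h _) x (ℕₚ.m≤m+n m (2 ℕ.* k)))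
  where m = length x

InM⇒HasP : ∀ {n} (τ : Tree n) → InM n τ → HasP (P τ) τ
InM⇒HasP {n} τ h =
  subst (λ τ′ → HasP (P τ′) τ′) (restrict-ext τ) (InMₙ⇒HasP n (ext τ) h)

HasP⇒InM : ∀ {n p} (τ : Tree n) → HasP p τ → InM n τ
HasP⇒InM {n} τ h = HasP⇒InMₙ n (ext τ) (subst (HasP _) (sym (restrict-ext τ)) h)

Pmod-restrict : ∀ n σ → Pmod σ [] (jj n) ≡ residue (P (restrict n σ)) (jj n)
Pmod-restrict n σ = residue-cong (≈-sym (P-restrict-jj n σ))

Pmod-restrict-2k : ∀ k σ → Pmod σ [] k ≡ residue (P (restrict (2 ℕ.* k) σ)) k
Pmod-restrict-2k k σ = subst (λ j → Pmod σ [] j ≡ residue (P (restrict (2 ℕ.* k) σ)) j)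
  (expo-[m+2k]-m 0 k) (Pmod-restrict (2 ℕ.* k) σ)

Pmod-ext : ∀ {n} (τ : Tree n) → Pmod (ext τ) [] (jj n) ≡ residue (P τ) (jj n)
Pmod-ext {n} τ = trans (Pmod-restrict n (ext τ))
  (cong (λ τ → residue (P τ) (jj n)) (restrict-ext τ))

residue-* : ∀ x y k → residue (x * y) k ≡ modPow (residue x k ℕ.* residue y k) k
residue-* x y k = trans
  (residue-cong {k} {x * y} {+ residue x k * + residue y k} (*-cong (≈-residue x) (≈-residue y)))
  (cong (λ z → residue z k) (sym (ℤₚ.pos-* (residue x k) (residue y k))))

residue-P-· : ∀ {n} {σ : Tree n} → HasP (P σ) σ → ∀ τ → residue (P (σ · τ)) (jj n) ≡
              modPow (residue (P σ) (jj n) ℕ.* residue (P τ) (jj n)) (jj n)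
residue-P-· {n} {σ} h τ = trans
  (residue-cong (subst (λ k → P (σ · τ) ≈[ k ] P σ * P τ) (sym (jj≡⌈n/2⌉ n)) (P-· h τ)))
  (residue-* (P σ) (P τ) (jj n))

-- M∞ and Mₙ as groups, and P as a homomorphism

M∞-∘ : ∀ σ τ → InM∞ σ → InM∞ τ → InM∞ (σ ∘ᵃ τ)
M∞-∘ σ τ hσ hτ = HasP⇒InM∞ λ n → subst (HasP _) (sym (restrict-∘ n σ τ))
  (HasP-· (InM∞⇒HasP hσ n) (InM∞⇒HasP hτ n))

HasP-inv′ : ∀ {n p} {τ : Tree n} → HasP p τ → HasP (P (inv τ)) (inv τ)
HasP-inv′ h = HasP-inv (P-inv h) h

M∞-inv : ∀ σ → InM∞ σ → InM∞ (invᵃ σ)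
M∞-inv σ hσ = HasP⇒InM∞ λ n → subst (HasP _) (sym (restrict-inv n σ))
  (HasP-inv′ (InM∞⇒HasP hσ n))

M∞-homo : ∀ σ τ → InM∞ σ → InM∞ τ → ∀ k →
  Pmod (σ ∘ᵃ τ) [] k ≡ modPow (Pmod σ [] k ℕ.* Pmod τ [] k) k
M∞-homo σ τ hσ hτ k = begin
  Pmod (σ ∘ᵃ τ) [] k
    ≡⟨ Pmod-restrict-2k k (σ ∘ᵃ τ) ⟩
  residue (P (restrict 2k (σ ∘ᵃ τ))) k
    ≡⟨ cong (λ τ → residue (P τ) k) (restrict-∘ 2k σ τ) ⟩
  residue (P (restrict 2k σ · restrict 2k τ)) k
    ≡⟨ subst (λ j → residue (P (restrict 2k σ · restrict 2k τ)) j ≡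
         modPow (residue (P (restrict 2k σ)) j ℕ.* residue (P (restrict 2k τ)) j) j)
         (expo-[m+2k]-m 0 k) (residue-P-· (InM∞⇒HasP hσ 2k) (restrict 2k τ)) ⟩
  modPow (residue (P (restrict 2k σ)) k ℕ.* residue (P (restrict 2k τ)) k) k
    ≡⟨ cong₂ (λ i j → modPow (i ℕ.* j) k) (Pmod-restrict-2k k σ) (Pmod-restrict-2k k τ) ⟨
  modPow (Pmod σ [] k ℕ.* Pmod τ [] k) k ∎
  where
  open ≡-Reasoning
  2k = 2 ℕ.* k

Mₙ-∘ : ∀ {n} (τ υ : Tree n) → InM n τ → InM n υ → InM n (τ ∘ₙ υ)
Mₙ-∘ τ υ hτ hυ = HasP⇒InM (τ ∘ₙ υ) (subst (HasP _) (sym (∘ₙ≡· τ υ))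
  (HasP-· (InM⇒HasP τ hτ) (InM⇒HasP υ hυ)))

Mₙ-inv : ∀ {n} (τ : Tree n) → InM n τ → InM n (invₙ τ)
Mₙ-inv τ hτ = HasP⇒InM (invₙ τ) (subst (HasP _) (sym (invₙ≡inv τ))
  (HasP-inv′ (InM⇒HasP τ hτ)))

Mₙ-homo : ∀ {n} (τ υ : Tree n) → InM n τ → InM n υ →
  Pmod (ext (τ ∘ₙ υ)) [] (jj n) ≡
  modPow (Pmod (ext τ) [] (jj n) ℕ.* Pmod (ext υ) [] (jj n)) (jj n)
Mₙ-homo {n} τ υ hτ hυ = begin
  Pmod (ext (τ ∘ₙ υ)) [] (jj n)    ≡⟨ Pmod-ext (τ ∘ₙ υ) ⟩
  residue (P (τ ∘ₙ υ)) (jj n)      ≡⟨ cong (λ τ → residue (P τ) (jj n)) (∘ₙ≡· τ υ) ⟩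
  residue (P (τ · υ)) (jj n)       ≡⟨ residue-P-· (InM⇒HasP τ hτ) υ ⟩
  modPow (residue (P τ) (jj n) ℕ.* residue (P υ) (jj n)) (jj n)
    ≡⟨ cong₂ (λ i j → modPow (i ℕ.* j) (jj n)) (Pmod-ext τ) (Pmod-ext υ) ⟨
  modPow (Pmod (ext τ) [] (jj n) ℕ.* Pmod (ext υ) [] (jj n)) (jj n) ∎
  where open ≡-Reasoning

-- Surjectivity of P

odd : ℤ → Bool
odd s with s %ℕ 2
... | zero  = false
... | suc _ = true

half : ℤ → ℤ
half s = s /ℕ 2

odd+2half : ∀ s → s ≡ par (odd s) + + 2 * half s
odd+2half s with s %ℕ 2 | n%ℕd<d s 2 | a≡a%ℕn+[a/ℕn]*n s 2
... | zero        | _             | eq = trans eq (cong (λ y → + 0 + y) (ℤₚ.*-comm (half s) (+ 2)))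
... | suc zero    | _             | eq = trans eq (cong (λ y → + 1 + y) (ℤₚ.*-comm (half s) (+ 2)))
... | suc (suc _) | s≤s (s≤s ()) | _

par-≈ : ∀ {c d} → par c ≈[ 1 ] par d → c ≡ d
par-≈ {c} {d} c≈d = parℕ-injective (<2^-unique {1} (parℕ<2 c) (parℕ<2 d) c≈d)
  where
  parℕ<2 : ∀ c → parℕ c < 2
  parℕ<2 false = s≤s z≤n
  parℕ<2 true  = s≤s (s≤s z≤n)
  parℕ-injective : ∀ {c d} → parℕ c ≡ parℕ d → c ≡ d
  parℕ-injective {false} {false} _ = refl
  parℕ-injective {true}  {true}  _ = refl

-- Reduction modulo 2 identifies the lowest bits; they cancel, and the rest is halved.
par+2-injective : ∀ {k c d x y} → par c + + 2 * x ≈[ suc k ] par d + + 2 * y →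
                  c ≡ d × x ≈[ k ] y
par+2-injective {k} {c} {d} {x} {y} eq with par-≈ {c} {d} (begin
  par c           ≈⟨ differBy x refl ⟨
  par c + + 2 * x ≈⟨ ≈-weaken (s≤s z≤n) eq ⟩
  par d + + 2 * y ≈⟨ differBy y refl ⟩
  par d           ∎)
  where open ≈-Reasoning 1
... | refl = refl , double-cancel (begin
  + 2 * x                       ≡⟨ lem (par c) (+ 2 * x) ⟨
  par c + + 2 * x + - par c     ≈⟨ +-congʳ (- par c) eq ⟩
  par c + + 2 * y + - par c     ≡⟨ lem (par c) (+ 2 * y) ⟩
  + 2 * y                       ∎)
  where
  open ≈-Reasoning (suc k)
  lem : ∀ c x → c + x + - c ≡ x
  lem = solve-∀

odd-half-≈ : ∀ {k s t} → s ≈[ suc k ] t → odd s ≡ odd t × half s ≈[ k ] half t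
odd-half-≈ {k} {s} {t} s≈t =
  par+2-injective (subst₂ (_≈[ suc k ]_) (odd+2half s) (odd+2half t) s≈t)

-- The parameters prescribe P = 1 + 2v, Q = s and Qₛ = t. The parity of s fixes the root and
-- `half s` fixes Qₛ of the left child; solving P = 1 + 2v then gives Qₛ of the right child. Q of
-- the left child is chosen to be 0, which leaves t for the right child.
build : ∀ n → (v s t : ℤ) → Tree n
build zero    v s t = leaf
build (suc n) v s t =
  node (odd s) (build n v (+ 0) (half s)) (build n v t (half s + v + par (odd s)))

build-Q : ∀ n v s t → Q (build n v s t) ≈[ ⌈ n /2⌉ ] s
build-Qₛ : ∀ n v s t → Qₛ (build n v s t) ≈[ ⌊ n /2⌋ ] t

build-Q zero    v s t = ≈-mod-1
build-Q (suc n) v s t = ≈-trans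
  (+-congˡ (par (odd s)) (double-cong (build-Qₛ n v (+ 0) (half s))))
  (≈-reflexive (sym (odd+2half s)))

build-Qₛ zero    v s t = ≈-mod-1
build-Qₛ (suc n) v s t = ≈-trans
  (+-cong (build-Q n v (+ 0) (half s)) (build-Q n v t (half s + v + par (odd s))))
  (≈-reflexive (ℤₚ.+-identityˡ t))

P-node-≈ : ∀ {k h v c x y} → x ≈[ k ] h → y ≈[ k ] h + v + par c →
           sgn c + + 2 * y - + 2 * x ≈[ suc k ] + 1 + + 2 * v
P-node-≈ {k} {h} {v} {c} {x} {y} x≈ y≈ = begin
  sgn c + + 2 * y - + 2 * x
    ≈⟨ +-cong (+-congˡ (sgn c) (double-cong y≈)) (neg-cong (double-cong x≈)) ⟩
  sgn c + + 2 * (h + v + par c) - + 2 * h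
    ≡⟨ cong (λ s → s + + 2 * (h + v + par c) - + 2 * h) (sgn≡1-2par c) ⟩
  + 1 - + 2 * par c + + 2 * (h + v + par c) - + 2 * h
    ≡⟨ lem h v (par c) ⟩
  + 1 + + 2 * v ∎
  where
  open ≈-Reasoning (suc k)
  lem : ∀ h v c → + 1 - + 2 * c + + 2 * (h + v + c) - + 2 * h ≡ + 1 + + 2 * v
  lem = solve-∀

build-HasP : ∀ n v s t → HasP (+ 1 + + 2 * v) (build n v s t)
build-HasP zero    v s t = leaf
build-HasP (suc n) v s t = node
  (P-node-≈ {h = half s} {c = odd s}
    (build-Qₛ n v (+ 0) (half s)) (build-Qₛ n v t (half s + v + par (odd s))))
  (build-HasP n v _ _) (build-HasP n v _ _)

-- Each level down costs at most one bit of the parameters, by halving, so the label at w depends on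
-- them only modulo a power of 2. Trees built from successive approximations of a 2-adic v therefore
-- fit together.
build-coherent : ∀ {m n v v′ s s′ t t′} w → length w < m → length w < n →
  v ≈[ suc (length w) ] v′ → s ≈[ suc (length w) ] s′ → t ≈[ suc (length w) ] t′ →
  ext (build m v s t) w ≡ ext (build n v′ s′ t′) w
build-coherent {suc m} {suc n} [] _ _ v≈ s≈ t≈ = proj₁ (odd-half-≈ s≈)
build-coherent {suc m} {suc n} (false ∷ w) (s≤s w<m) (s≤s w<n) v≈ s≈ t≈ =
  build-coherent w w<m w<n (≈-pred v≈) ≈-refl (proj₂ (odd-half-≈ s≈))
build-coherent {suc m} {suc n} {s = s} {s′} (true ∷ w) (s≤s w<m) (s≤s w<n) v≈ s≈ t≈
  with o , h ← odd-half-≈ {s = s} {s′} s≈ =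
  build-coherent w w<m w<n (≈-pred v≈) (≈-pred t≈)
    (+-cong (+-cong h (≈-pred v≈)) (≈-reflexive (cong par o)))

val-suc : ∀ u k → val u (suc k) ≡ parℕ (u 0) ℕ.+ 2 ℕ.* val (λ i → u (suc i)) k
val-suc u zero    = trans (ℕₚ.*-identityˡ (parℕ (u 0))) (sym (ℕₚ.+-identityʳ (parℕ (u 0))))
val-suc u (suc k) rewrite val-suc u k =
  lem (parℕ (u 0)) (val (λ i → u (suc i)) k) (2 ^ k) (parℕ (u (suc k)))
  where
  lem : ∀ p v m q → p ℕ.+ 2 ℕ.* v ℕ.+ 2 ℕ.* m ℕ.* q ≡ p ℕ.+ 2 ℕ.* (v ℕ.+ m ℕ.* q)
  lem = ℕ-Solver.solve-∀

val-truncate : ∀ {j k} u → j ≤ k → + val u k ≈[ j ] + val u j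
val-truncate u j≤k = go (ℕₚ.≤⇒≤′ j≤k)
  where
  go : ∀ {j k} → j ℕ.≤′ k → + val u k ≈[ j ] + val u j
  go ℕ.≤′-refl = ≈-refl
  go {j} {suc k} (ℕ.≤′-step j≤k) = ≈-trans
    (≈-weaken (ℕₚ.≤′⇒≤ j≤k) (differBy (par (u k))
      (cong (λ y → + val u k + y) (ℤₚ.pos-* (2 ^ k) (parℕ (u k))))))
    (go j≤k)

val<2^ : ∀ u k → val u k < 2 ^ k
val<2^ u zero    = s≤s z≤n
val<2^ u (suc k) = subst (val u (suc k) <_) (cong (2 ^ k ℕ.+_) (sym (ℕₚ.+-identityʳ (2 ^ k))))
  (ℕₚ.+-mono-<-≤ (val<2^ u k) (ℕₚ.≤-trans (ℕₚ.*-monoʳ-≤ (2 ^ k) (parℕ≤1 (u k)))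
                                        (ℕₚ.≤-reflexive (ℕₚ.*-identityʳ (2 ^ k)))))
  where
  parℕ≤1 : ∀ c → parℕ c ≤ 1
  parℕ≤1 false = z≤n
  parℕ≤1 true  = s≤s z≤n

residue-unique : ∀ {k x i} → i < 2 ^ k → x ≈[ k ] + i → residue x k ≡ i
residue-unique {k} {x} i< x≈i =
  <2^-unique (residue-< x k) i< (≈-trans (≈-sym (≈-residue x)) x≈i)

M∞-surjective : ∀ u → IsUnit₂ u → ∃[ σ ] (InM∞ σ × (∀ k → Pmod σ [] k ≡ val u k))
M∞-surjective u unit = σ , HasP⇒InM∞ σ-HasP , Pmod-σ
  where
  -- Dropping the lowest digit of u, which is 1, gives v with u = 1 + 2v.
  v : ℤ₂
  v i = u (suc i)
  τ : ∀ n → Tree n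
  τ n = build n (+ val v n) (+ 0) (+ 0)
  σ : Aut∞
  -- `suc (length w)` is the least height of a tree that has a label at w.
  σ w = ext (τ (suc (length w))) w
  restrict-σ : ∀ n → restrict n σ ≡ τ n
  restrict-σ n = trans
    (restrict-cong n λ w w<n → build-coherent w ℕₚ.≤-refl w<n
      (≈-sym (val-truncate v w<n)) ≈-refl ≈-refl)
    (restrict-ext (τ n))
  σ-HasP : ∀ n → HasP (+ 1 + + 2 * + val v n) (restrict n σ)
  σ-HasP n = subst (HasP _) (sym (restrict-σ n)) (build-HasP n _ _ _)
  val-u : ∀ k → + val u (suc k) ≡ + 1 + + 2 * + val v k
  val-u k = trans (cong +_ (trans (val-suc u k) (cong (λ c → parℕ c ℕ.+ 2 ℕ.* val v k) unit)))
    (cong (λ y → + 1 + y) (ℤₚ.pos-* 2 (val v k)))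
  Pmod-σ : ∀ k → Pmod σ [] k ≡ val u k
  Pmod-σ k = trans (Pmod-restrict-2k k σ) (residue-unique (val<2^ u k) (begin
    P (restrict 2k σ)       ≈⟨ subst (λ j → P (restrict 2k σ) ≈[ j ] + 1 + + 2 * + val v 2k)
                                 ⌈2k/2⌉≡k (HasP-P (σ-HasP 2k)) ⟩
    + 1 + + 2 * + val v 2k  ≡⟨ val-u 2k ⟨
    + val u (suc 2k)        ≈⟨ val-truncate u (ℕₚ.m≤n⇒m≤1+n (ℕₚ.m≤m+n k _)) ⟩
    + val u k               ∎))
    where
    open ≈-Reasoning k
    2k = 2 ℕ.* k
    ⌈2k/2⌉≡k : ⌈ 2k /2⌉ ≡ k
    ⌈2k/2⌉≡k = trans (sym (jj≡⌈n/2⌉ 2k)) (expo-[m+2k]-m 0 k)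

Mₙ-surjective : ∀ n u → u < 2 ^ jj n → u % 2 ≡ 1 →
  ∃[ τ ] (InM n τ × Pmod (ext τ) [] (jj n) ≡ u)
Mₙ-surjective n u u< odd-u = τ , HasP⇒InM τ τ-HasP ,
  trans (Pmod-ext τ) (residue-unique u<
    (subst₂ (P τ ≈[_]_) (sym (jj≡⌈n/2⌉ n)) (sym u≡) (HasP-P τ-HasP)))
  where
  v = u ℕ./ 2
  τ = build n (+ v) (+ 0) (+ 0)
  τ-HasP = build-HasP n (+ v) (+ 0) (+ 0)
  u≡ : + u ≡ + 1 + + 2 * + v
  u≡ = trans (cong +_ (trans (ℕₚ.m≡m%n+[m/n]*n u 2)
               (cong₂ ℕ._+_ odd-u (ℕₚ.*-comm v 2))))
             (cong (λ y → + 1 + y) (ℤₚ.pos-* 2 v))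

-- The cardinality of Mₙ

HasCard-⇔ : ∀ {A : Set} {X Y : A → Set} {k} → (∀ x → X x ⇔ Y x) → HasCard X k → HasCard Y k
HasCard-⇔ X⇔Y (L , unique , ∈L⇔X , len) =
  L , unique , (λ x → mk⇔ (λ x∈ → to (X⇔Y x) (to (∈L⇔X x) x∈))
                          (λ y → from (∈L⇔X x) (from (X⇔Y x) y))) , len
  where open Equivalence

-- For counting by an invariant: the index will be a residue obtained from P, Q or Qₛ, and
-- disjointness says that the tree determines it.
HasCard-⨄ : ∀ {A : Set} {X : ℕ → A → Set} {N} K → (∀ i → HasCard (X i) N) →
  (∀ {i j x} → i < K → j < K → X i x → X j x → i ≡ j) →
  HasCard (λ x → ∃ λ i → i < K × X i x) (K ℕ.* N)
HasCard-⨄ zero card disjoint = [] , AllPairs.[] , (λ x → mk⇔ (λ ()) λ ()) , refl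
HasCard-⨄ {X = X} (suc K) card disjoint
  with L , uL , ∈L⇔X , lenL ← card K
     | R , uR , ∈R⇔X , lenR ← HasCard-⨄ K card
         (λ i<K j<K → disjoint (ℕₚ.m<n⇒m<1+n i<K) (ℕₚ.m<n⇒m<1+n j<K)) =
  L ++ R , Unique.++⁺ uL uR L#R , (λ x → mk⇔ (f x) (g x)) ,
  trans (length-++ L) (cong₂ ℕ._+_ lenL lenR)
  where
  open Equivalence
  L#R : ∀ {x} → x ∈ L × x ∈ R → _
  L#R {x} (x∈L , x∈R) with i , i<K , Xi ← to (∈R⇔X x) x∈R =
    ℕₚ.<⇒≢ i<K (disjoint (ℕₚ.m<n⇒m<1+n i<K) ℕₚ.≤-refl Xi (to (∈L⇔X x) x∈L))
  f : ∀ x → x ∈ L ++ R → ∃ λ i → i < suc K × X i x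
  f x x∈ with ∈-++⁻ L x∈
  ... | inj₁ x∈L = K , ℕₚ.≤-refl , to (∈L⇔X x) x∈L
  ... | inj₂ x∈R with i , i<K , Xi ← to (∈R⇔X x) x∈R = i , ℕₚ.m<n⇒m<1+n i<K , Xi
  g : ∀ x → (∃ λ i → i < suc K × X i x) → x ∈ L ++ R
  g x (i , s≤s i≤K , Xi) with ℕₚ.m≤n⇒m<n∨m≡n i≤K
  ... | inj₁ i<K  = ∈-++⁺ʳ L (from (∈R⇔X x) (i , i<K , Xi))
  ... | inj₂ refl = ∈-++⁺ˡ (from (∈L⇔X x) Xi)

length-cartesianProductWith : ∀ {A B C : Set} (f : A → B → C) xs ys →
  length (cartesianProductWith f xs ys) ≡ length xs ℕ.* length ys
length-cartesianProductWith f []       ys = refl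
length-cartesianProductWith f (x ∷ xs) ys = trans (length-++ (map (f x) ys))
  (cong₂ ℕ._+_ (length-map (f x) ys) (length-cartesianProductWith f xs ys))

HasCard-node : ∀ {n X Y N M} (c : Bool) → HasCard {Tree n} X N → HasCard {Tree n} Y M →
  HasCard (λ τ → ∃ λ l → ∃ λ r → τ ≡ node c l r × X l × Y r) (N ℕ.* M)
HasCard-node {X = X} {Y} c (L , uL , ∈L⇔X , lenL) (R , uR , ∈R⇔Y , lenR) =
  cartesianProductWith (node c) L R ,
  Unique.cartesianProductWith⁺ (node c) (λ { refl → refl , refl }) uL uR ,
  (λ τ → mk⇔ (f τ) (g τ)) ,
  trans (length-cartesianProductWith (node c) L R) (cong₂ ℕ._*_ lenL lenR)
  where
  open Equivalence
  f : ∀ τ → τ ∈ cartesianProductWith (node c) L R →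
      ∃ λ l → ∃ λ r → τ ≡ node c l r × X l × Y r
  f τ τ∈ with l , r , l∈ , r∈ , eq ← ∈-cartesianProductWith⁻ (node c) L R τ∈ =
    l , r , eq , to (∈L⇔X l) l∈ , to (∈R⇔Y r) r∈
  g : ∀ τ → (∃ λ l → ∃ λ r → τ ≡ node c l r × X l × Y r) →
      τ ∈ cartesianProductWith (node c) L R
  g τ (l , r , refl , Xl , Yr) =
    ∈-cartesianProductWith⁺ (node c) (from (∈L⇔X l) Xl) (from (∈R⇔Y r) Yr)

-- The fibres over which Mₙ is counted. Their size does not depend on v, s and t, which makes the
-- induction on n possible.
Class : ∀ n (v s t : ℤ) → Tree n → Set
Class n v s t τ =
  HasP (+ 1 + + 2 * v) τ × Q τ ≈[ ⌈ n /2⌉ ] s × Qₛ τ ≈[ ⌊ n /2⌋ ] t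

-- The number q is the value of Q at the left child, the one free choice; the remaining data of both
-- children are forced as in `build`.
ClassNode : ∀ n (v s t : ℤ) → Tree (suc n) → ℕ → Set
ClassNode n v s t τ q = ∃ λ l → ∃ λ r → τ ≡ node (odd s) l r ×
  Class n v (+ q) (half s) l × Class n v (t - + q) (half s + v + par (odd s)) r

Class⇔ClassNode : ∀ n v s t τ →
  (∃ λ q → q < 2 ^ ⌈ n /2⌉ × ClassNode n v s t τ q) ⇔ Class (suc n) v s t τ
Class⇔ClassNode n v s t τ = mk⇔ f (g τ)
  where
  f : (∃ λ q → q < 2 ^ ⌈ n /2⌉ × ClassNode n v s t τ q) → Class (suc n) v s t τ
  f (q , q< , l , r , refl , (hl , Ql , Qₛl) , (hr , Qr , Qₛr)) =
    node (P-node-≈ {h = half s} {c = odd s} Qₛl Qₛr) hl hr ,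
    ≈-trans (+-congˡ (par (odd s)) (double-cong Qₛl)) (≈-reflexive (sym (odd+2half s))) ,
    ≈-trans (+-cong Ql Qr) (≈-reflexive (lem (+ q) t))
    where
    lem : ∀ q t → q + (t - q) ≡ t
    lem = solve-∀
  g : ∀ τ → Class (suc n) v s t τ → ∃ λ q → q < 2 ^ ⌈ n /2⌉ × ClassNode n v s t τ q
  -- The congruence for Q alone determines the root parity and Qₛ of the left child.
  g (node c l r) (node P≈ hl hr , Q≈s , Qₛ≈t)
    with refl , Qₛl ← par+2-injective {c = c} {odd s} {Qₛ l} {half s}
                        (≈-trans Q≈s (≈-reflexive (odd+2half s))) =
    q , residue-< (Q l) ⌈ n /2⌉ , l , r , refl ,
    (hl , ≈-residue (Q l) , Qₛl) , (hr , Qr , Qₛr)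
    where
    q = residue (Q l) ⌈ n /2⌉
    Qr : Q r ≈[ ⌈ n /2⌉ ] t - + q
    Qr = begin
      Q r             ≡⟨ lem (Q l) (Q r) ⟩
      Q l + Q r - Q l ≈⟨ +-cong Qₛ≈t (neg-cong (≈-residue (Q l))) ⟩
      t - + q         ∎
      where
      open ≈-Reasoning ⌈ n /2⌉
      lem : ∀ x y → y ≡ x + y - x
      lem = solve-∀
    -- P ≈ 1 + 2v is solved for Qₛ r; division by 2 costs one bit.
    Qₛr : Qₛ r ≈[ ⌊ n /2⌋ ] half s + v + par c
    Qₛr = double-cancel (begin
      + 2 * Qₛ r
        ≡⟨ lem₁ (sgn c) (Qₛ l) (Qₛ r) ⟩
      P (node c l r) - sgn c + + 2 * Qₛ l
        ≈⟨ +-cong (+-congʳ (- sgn c) P≈) (double-cong Qₛl) ⟩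
      + 1 + + 2 * v - sgn c + + 2 * half s
        ≡⟨ cong (λ z → + 1 + + 2 * v - z + + 2 * half s) (sgn≡1-2par c) ⟩
      + 1 + + 2 * v - (+ 1 - + 2 * par c) + + 2 * half s
        ≡⟨ lem₂ v (par c) (half s) ⟩
      + 2 * (half s + v + par c) ∎)
      where
      open ≈-Reasoning (suc ⌊ n /2⌋)
      lem₁ : ∀ c l r → + 2 * r ≡ c + + 2 * r - + 2 * l - c + + 2 * l
      lem₁ = solve-∀
      lem₂ : ∀ v c h → + 1 + + 2 * v - (+ 1 - + 2 * c) + + 2 * h ≡ + 2 * (h + v + c)
      lem₂ = solve-∀

-- The free residue q accounts for `⌈ n /2⌉` bits, and each of the two children is chosen from a
-- class of its own.
classExp : ℕ → ℕ
classExp zero    = 0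
classExp (suc n) = ⌈ n /2⌉ ℕ.+ (classExp n ℕ.+ classExp n)

≈-unique : ∀ {k x i j} → i < 2 ^ k → j < 2 ^ k → x ≈[ k ] + i → x ≈[ k ] + j → i ≡ j
≈-unique i< j< x≈i x≈j = <2^-unique i< j< (≈-trans (≈-sym x≈i) x≈j)

HasCard-Class : ∀ n v s t → HasCard (Class n v s t) (2 ^ classExp n)
HasCard-Class zero v s t = (leaf ∷ []) , (All.[] AllPairs.∷ AllPairs.[]) ,
  (λ { leaf → mk⇔ (λ _ → leaf , ≈-mod-1 , ≈-mod-1) (λ _ → here refl) }) , refl
HasCard-Class (suc n) v s t = HasCard-⇔ (Class⇔ClassNode n v s t)
  (subst (HasCard _) size (HasCard-⨄ (2 ^ ⌈ n /2⌉)
    (λ q → HasCard-node (odd s) (HasCard-Class n v (+ q) (half s))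
                                (HasCard-Class n v (t - + q) (half s + v + par (odd s))))
    λ { i< j< (_ , _ , refl , (_ , Q≈i , _) , _) (_ , _ , refl , (_ , Q≈j , _) , _) →
        ≈-unique i< j< Q≈i Q≈j }))
  where
  e = classExp n
  size : 2 ^ ⌈ n /2⌉ ℕ.* (2 ^ e ℕ.* 2 ^ e) ≡ 2 ^ (⌈ n /2⌉ ℕ.+ (e ℕ.+ e))
  size = trans (cong (2 ^ ⌈ n /2⌉ ℕ.*_) (sym (ℕₚ.^-distribˡ-+-* 2 e e)))
               (sym (ℕₚ.^-distribˡ-+-* 2 ⌈ n /2⌉ (e ℕ.+ e)))

-- P is odd, so v needs one bit less than s. The bounds use that `⌈ suc m /2⌉` is `suc ⌊ m /2⌋` and
-- `⌊ suc m /2⌋` is `⌈ m /2⌉`.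
MClass : ∀ m → Tree (suc m) → Set
MClass m τ = ∃ λ v → v < 2 ^ ⌊ m /2⌋ × ∃ λ s → s < 2 ^ suc ⌊ m /2⌋ ×
  ∃ λ t → t < 2 ^ ⌈ m /2⌉ × Class (suc m) (+ v) (+ s) (+ t) τ

MClass⇔InM : ∀ m τ → MClass m τ ⇔ InM (suc m) τ
MClass⇔InM m τ = mk⇔ (λ (_ , _ , _ , _ , _ , _ , h , _) → HasP⇒InM τ h)
  (λ h → g τ (InM⇒HasP τ h))
  where
  g : ∀ τ → HasP (P τ) τ → MClass m τ
  g τ@(node c l r) h =
    residue w ⌊ m /2⌋ , residue-< w ⌊ m /2⌋ ,
    residue (Q τ) (suc ⌊ m /2⌋) , residue-< (Q τ) (suc ⌊ m /2⌋) ,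
    residue (Qₛ τ) ⌈ m /2⌉ , residue-< (Qₛ τ) ⌈ m /2⌉ ,
    HasP-resp P≈ h , ≈-residue (Q τ) , ≈-residue (Qₛ τ)
    where
    w = Qₛ r - Qₛ l - par c
    lem : ∀ c l r → + 1 - + 2 * c + + 2 * r - + 2 * l ≡ + 1 + + 2 * (r - l - c)
    lem = solve-∀
    P≈ : P τ ≈[ suc ⌊ m /2⌋ ] + 1 + + 2 * + residue w ⌊ m /2⌋
    P≈ = ≈-trans (≈-reflexive (trans
      (cong (λ s → s + + 2 * Qₛ r - + 2 * Qₛ l) (sgn≡1-2par c)) (lem (par c) (Qₛ l) (Qₛ r))))
      (+-congˡ (+ 1) (double-cong (≈-residue w)))

1+2*-injective : ∀ {k v w} → + 1 + + 2 * v ≈[ suc k ] + 1 + + 2 * w → v ≈[ k ] w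
1+2*-injective h = proj₂ (par+2-injective {c = true} {true} h)

mShift : ℕ → ℕ
mShift n = if evenᵇ n then 5 else 4

⌊n/2⌋+5≡⌈n/2⌉+mShift : ∀ n → ⌊ n /2⌋ ℕ.+ 5 ≡ ⌈ n /2⌉ ℕ.+ mShift n
⌊n/2⌋+5≡⌈n/2⌉+mShift zero          = refl
⌊n/2⌋+5≡⌈n/2⌉+mShift (suc zero)    = refl
⌊n/2⌋+5≡⌈n/2⌉+mShift (suc (suc n)) = cong suc (⌊n/2⌋+5≡⌈n/2⌉+mShift n)

-- Written without division and subtraction; the induction goes in steps of two because `mShift`
-- depends on the parity of n.
classExp-closed : ∀ n →
  3 ℕ.* classExp n ℕ.+ 3 ℕ.* ⌈ n /2⌉ ℕ.+ mShift n ≡ 2 ^ (n ℕ.+ 1) ℕ.+ 3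
classExp-closed zero          = refl
classExp-closed (suc zero)    = refl
-- Adding 9 turns both sides into four times those of the induction hypothesis, as 4 · 3 = 3 + 9.
classExp-closed (suc (suc n)) = ℕₚ.+-cancelʳ-≡ 9 _ _ (begin
  3 ℕ.* (suc f ℕ.+ ((g ℕ.+ (e ℕ.+ e)) ℕ.+ (g ℕ.+ (e ℕ.+ e)))) ℕ.+ 3 ℕ.* suc g ℕ.+ c ℕ.+ 9
    ≡⟨ lem₁ f g e c ⟩
  3 ℕ.* (f ℕ.+ 5) ℕ.+ (9 ℕ.* g ℕ.+ 12 ℕ.* e ℕ.+ c)
    ≡⟨ cong (λ x → 3 ℕ.* x ℕ.+ (9 ℕ.* g ℕ.+ 12 ℕ.* e ℕ.+ c)) (⌊n/2⌋+5≡⌈n/2⌉+mShift n) ⟩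
  3 ℕ.* (g ℕ.+ c) ℕ.+ (9 ℕ.* g ℕ.+ 12 ℕ.* e ℕ.+ c)
    ≡⟨ lem₂ g e c ⟩
  4 ℕ.* (3 ℕ.* e ℕ.+ 3 ℕ.* g ℕ.+ c)
    ≡⟨ cong (4 ℕ.*_) (classExp-closed n) ⟩
  4 ℕ.* (2 ^ (n ℕ.+ 1) ℕ.+ 3)
    ≡⟨ lem₃ (2 ^ (n ℕ.+ 1)) ⟩
  2 ^ (suc (suc n) ℕ.+ 1) ℕ.+ 3 ℕ.+ 9 ∎)
  where
  open ≡-Reasoning
  f = ⌊ n /2⌋
  g = ⌈ n /2⌉
  e = classExp n
  c = mShift n
  lem₁ : ∀ f g e c →
    3 ℕ.* (1 ℕ.+ f ℕ.+ ((g ℕ.+ (e ℕ.+ e)) ℕ.+ (g ℕ.+ (e ℕ.+ e)))) ℕ.+ 3 ℕ.* (1 ℕ.+ g) ℕ.+ c ℕ.+ 9 ≡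
    3 ℕ.* (f ℕ.+ 5) ℕ.+ (9 ℕ.* g ℕ.+ 12 ℕ.* e ℕ.+ c)
  lem₁ = ℕ-Solver.solve-∀
  lem₂ : ∀ g e c → 3 ℕ.* (g ℕ.+ c) ℕ.+ (9 ℕ.* g ℕ.+ 12 ℕ.* e ℕ.+ c) ≡
         4 ℕ.* (3 ℕ.* e ℕ.+ 3 ℕ.* g ℕ.+ c)
  lem₂ = ℕ-Solver.solve-∀
  lem₃ : ∀ x → 4 ℕ.* (x ℕ.+ 3) ≡ 2 ℕ.* (2 ℕ.* x) ℕ.+ 3 ℕ.+ 9
  lem₃ = ℕ-Solver.solve-∀

-- The summands are the bits of v, s and t and those of a single class. Multiplied by 3 and
-- increased by `mShift`, the sum becomes the minuend in `mExp`, so subtraction and division there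
-- are exact.
mExp-suc : ∀ m →
  ⌊ m /2⌋ ℕ.+ (suc ⌊ m /2⌋ ℕ.+ (⌈ m /2⌉ ℕ.+ classExp (suc m))) ≡ mExp (suc m)
mExp-suc m = sym (begin
  (2 ^ (n ℕ.+ 1) ℕ.+ 3 ℕ.* n ℕ.∸ c) ℕ./ 3 ≡⟨ cong (λ x → (x ℕ.∸ c) ℕ./ 3) eq ⟨
  (E ℕ.* 3 ℕ.+ c ℕ.∸ c) ℕ./ 3             ≡⟨ cong (ℕ._/ 3) (ℕₚ.m+n∸n≡m (E ℕ.* 3) c) ⟩
  E ℕ.* 3 ℕ./ 3                           ≡⟨ ℕₚ.m*n/n≡m E 3 ⟩
  E                                       ∎)
  where
  open ≡-Reasoning
  n = suc m
  f = ⌊ m /2⌋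
  g = ⌈ m /2⌉
  e = classExp n
  c = mShift n
  E = f ℕ.+ (suc f ℕ.+ (g ℕ.+ e))
  lem₁ : ∀ f g e c → (f ℕ.+ ((1 ℕ.+ f) ℕ.+ (g ℕ.+ e))) ℕ.* 3 ℕ.+ c ≡
         3 ℕ.* e ℕ.+ 3 ℕ.* (1 ℕ.+ f) ℕ.+ c ℕ.+ 3 ℕ.* (f ℕ.+ g)
  lem₁ = ℕ-Solver.solve-∀
  lem₂ : ∀ x m → x ℕ.+ 3 ℕ.+ 3 ℕ.* m ≡ x ℕ.+ 3 ℕ.* (1 ℕ.+ m)
  lem₂ = ℕ-Solver.solve-∀
  eq : E ℕ.* 3 ℕ.+ c ≡ 2 ^ (n ℕ.+ 1) ℕ.+ 3 ℕ.* n
  eq = begin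
    E ℕ.* 3 ℕ.+ c
      ≡⟨ lem₁ f g e c ⟩
    3 ℕ.* e ℕ.+ 3 ℕ.* ⌈ n /2⌉ ℕ.+ c ℕ.+ 3 ℕ.* (f ℕ.+ g)
      ≡⟨ cong₂ (λ x y → x ℕ.+ 3 ℕ.* y) (classExp-closed n) (ℕₚ.⌊n/2⌋+⌈n/2⌉≡n m) ⟩
    2 ^ (n ℕ.+ 1) ℕ.+ 3 ℕ.+ 3 ℕ.* m
      ≡⟨ lem₂ (2 ^ (n ℕ.+ 1)) m ⟩
    2 ^ (n ℕ.+ 1) ℕ.+ 3 ℕ.* n ∎

HasCard-M : ∀ m → HasCard (InM (suc m)) (2 ^ mExp (suc m))
HasCard-M m = HasCard-⇔ (MClass⇔InM m) (subst (HasCard _) size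
  (HasCard-⨄ (2 ^ ⌊ m /2⌋) (λ v → HasCard-⨄ (2 ^ suc ⌊ m /2⌋) (λ s → HasCard-⨄ (2 ^ ⌈ m /2⌉)
    (λ t → HasCard-Class (suc m) (+ v) (+ s) (+ t))
    λ { i< j< (_ , _ , Qₛ≈i) (_ , _ , Qₛ≈j) → ≈-unique {⌈ m /2⌉} i< j< Qₛ≈i Qₛ≈j })
    λ { i< j< (_ , _ , _ , Q≈i , _) (_ , _ , _ , Q≈j , _) → ≈-unique {suc ⌊ m /2⌋} i< j< Q≈i Q≈j })
    λ { i< j< (_ , _ , _ , _ , hi , _) (_ , _ , _ , _ , hj , _) →
        <2^-unique {⌊ m /2⌋} i< j< (1+2*-injective (≈-trans (≈-sym (HasP-P hi)) (HasP-P hj))) }))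
  where
  x = ⌊ m /2⌋
  y = suc ⌊ m /2⌋
  z = ⌈ m /2⌉
  e = classExp (suc m)
  open ≡-Reasoning
  size : 2 ^ x ℕ.* (2 ^ y ℕ.* (2 ^ z ℕ.* 2 ^ e)) ≡ 2 ^ mExp (suc m)
  size = begin
    2 ^ x ℕ.* (2 ^ y ℕ.* (2 ^ z ℕ.* 2 ^ e))
      ≡⟨ cong (λ n → 2 ^ x ℕ.* (2 ^ y ℕ.* n)) (ℕₚ.^-distribˡ-+-* 2 z e) ⟨
    2 ^ x ℕ.* (2 ^ y ℕ.* 2 ^ (z ℕ.+ e))
      ≡⟨ cong (2 ^ x ℕ.*_) (ℕₚ.^-distribˡ-+-* 2 y (z ℕ.+ e)) ⟨
    2 ^ x ℕ.* 2 ^ (y ℕ.+ (z ℕ.+ e))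
      ≡⟨ ℕₚ.^-distribˡ-+-* 2 x (y ℕ.+ (z ℕ.+ e)) ⟨
    2 ^ (x ℕ.+ (y ℕ.+ (z ℕ.+ e)))
      ≡⟨ cong (2 ^_) (mExp-suc m) ⟩
    2 ^ mExp (suc m) ∎

-- The kernel of P

infixr 8 _^ₜ_

_^ₜ_ : ∀ {n} → Tree n → ℕ → Tree n
τ ^ₜ zero  = 1ₜ
τ ^ₜ suc k = τ · τ ^ₜ k

^ₜ-+ : ∀ {n} (τ : Tree n) j k → τ ^ₜ (j ℕ.+ k) ≡ τ ^ₜ j · τ ^ₜ k
^ₜ-+ τ zero    k = sym (·-identityˡ _)
^ₜ-+ τ (suc j) k = trans (cong (τ ·_) (^ₜ-+ τ j k)) (sym (·-assoc τ _ _))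

^ₜ-multiple : ∀ {n} {τ : Tree n} {j} → τ ^ₜ j ≡ 1ₜ → ∀ q → τ ^ₜ (q ℕ.* j) ≡ 1ₜ
^ₜ-multiple eq zero = refl
^ₜ-multiple {τ = τ} {j} eq (suc q) = trans (^ₜ-+ τ j (q ℕ.* j))
  (trans (cong₂ _·_ eq (^ₜ-multiple eq q)) (·-identityˡ 1ₜ))

-- Expresses the inverse of an element of finite order as a positive power.
^ₜ-pred : ∀ {n} {τ : Tree n} j .{{_ : ℕ.NonZero j}} → τ ^ₜ j ≡ 1ₜ →
          τ ^ₜ ℕ.pred j · τ ≡ 1ₜ
^ₜ-pred {τ = τ} (suc m) eq = begin
  τ ^ₜ m · τ      ≡⟨ cong (τ ^ₜ m ·_) (·-identityʳ τ) ⟨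
  τ ^ₜ m · τ ^ₜ 1 ≡⟨ ^ₜ-+ τ m 1 ⟨
  τ ^ₜ (m ℕ.+ 1)  ≡⟨ cong (τ ^ₜ_) (ℕₚ.+-comm m 1) ⟩
  τ ^ₜ suc m      ≡⟨ eq ⟩
  1ₜ              ∎
  where open ≡-Reasoning

αₜ βₜ : ∀ {n} → Tree n
αₜ {zero}  = leaf
αₜ {suc n} = node true 1ₜ βₜ
βₜ {zero}  = leaf
βₜ {suc n} = node false 1ₜ αₜ

βₜ-^ₜ : ∀ {n} k → βₜ {suc n} ^ₜ k ≡ node false 1ₜ (αₜ ^ₜ k)
βₜ-^ₜ zero    = refl
βₜ-^ₜ (suc k) = trans (cong (βₜ ·_) (βₜ-^ₜ k)) (cong₂ (node false) (·-identityˡ 1ₜ) refl)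

-- This is α² = (β, β), in a form that applies directly in front of a word.
αₜ·αₜ· : ∀ {n} (x y : Tree n) → αₜ · (αₜ · node false x y) ≡ node false (βₜ · x) (βₜ · y)
αₜ·αₜ· x y = cong₂ (node false) (cong (βₜ ·_) (·-identityˡ x)) (·-identityˡ _)

αₜ-^ₜ : ∀ {n} k → αₜ {suc n} ^ₜ (2 ℕ.* k) ≡ node false (βₜ ^ₜ k) (βₜ ^ₜ k)
αₜ-^ₜ zero    = refl
αₜ-^ₜ (suc k) = begin
  αₜ ^ₜ (2 ℕ.* suc k)        ≡⟨ cong (λ j → αₜ · αₜ ^ₜ j) (ℕₚ.+-suc k (k ℕ.+ 0)) ⟩
  αₜ · (αₜ · αₜ ^ₜ (2 ℕ.* k)) ≡⟨ cong (λ τ → αₜ · (αₜ · τ)) (αₜ-^ₜ k) ⟩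
  αₜ · (αₜ · node false (βₜ ^ₜ k) (βₜ ^ₜ k)) ≡⟨ αₜ·αₜ· (βₜ ^ₜ k) (βₜ ^ₜ k) ⟩
  node false (βₜ ^ₜ suc k) (βₜ ^ₜ suc k) ∎
  where open ≡-Reasoning

-- By α² = (β, β) and β = (1, α), the order doubles only in passing from β to α.
αₜ-order : ∀ n → αₜ {n} ^ₜ (2 ^ ⌈ n /2⌉) ≡ 1ₜ
βₜ-order : ∀ n → βₜ {n} ^ₜ (2 ^ ⌊ n /2⌋) ≡ 1ₜ
αₜ-order zero    = refl
αₜ-order (suc n) = trans (αₜ-^ₜ (2 ^ ⌊ n /2⌋)) (cong₂ (node false) (βₜ-order n) (βₜ-order n))
βₜ-order zero    = refl
βₜ-order (suc n) = trans (βₜ-^ₜ (2 ^ ⌈ n /2⌉)) (cong (node false 1ₜ) (αₜ-order n))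

βₜ-^ₜ≡1ₜ : ∀ {n} k → + k ≈[ ⌊ n /2⌋ ] + 0 → βₜ {n} ^ₜ k ≡ 1ₜ
βₜ-^ₜ≡1ₜ {n} k k≈0 = trans (cong (βₜ ^ₜ_) k≡qN) (^ₜ-multiple (βₜ-order n) (k ℕ./ 2 ^ ⌊ n /2⌋))
  where
  instance _ = ℕₚ.m^n≢0 2 ⌊ n /2⌋
  N = 2 ^ ⌊ n /2⌋
  k≡qN : k ≡ k ℕ./ N ℕ.* N
  k≡qN = trans (ℕₚ.m≡m%n+[m/n]*n k N) (cong (ℕ._+ k ℕ./ N ℕ.* N)
    (residue-unique {⌊ n /2⌋} {+ k} (ℕₚ.m^n>0 2 ⌊ n /2⌋) k≈0))

-- Values of Q and P on the generators

Q-1ₜ : ∀ n → Q (1ₜ {n}) ≡ + 0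
Qₛ-1ₜ : ∀ n → Qₛ (1ₜ {n}) ≡ + 0
Q-1ₜ zero     = refl
Q-1ₜ (suc n)  = cong (λ x → + 0 + + 2 * x) (Qₛ-1ₜ n)
Qₛ-1ₜ zero    = refl
Qₛ-1ₜ (suc n) = cong₂ _+_ (Q-1ₜ n) (Q-1ₜ n)

Qₛ-αₜ : ∀ n → Qₛ (αₜ {n}) ≡ + 0
Qₛ-αₜ zero          = refl
Qₛ-αₜ (suc zero)    = refl
Qₛ-αₜ (suc (suc n)) = cong₂ _+_ (Q-1ₜ (suc n)) (cong (λ x → + 0 + + 2 * x) (Qₛ-1ₜ n))

-- From height two on, the 1 is the root parity of α, the right child of β. At heights 0 and 1 the
-- sum is 0 and the modulus is 1.
Qₛ-βₜ : ∀ n → Qₛ (βₜ {n}) ≈[ ⌊ n /2⌋ ] + 1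
Qₛ-βₜ zero          = ≈-mod-1
Qₛ-βₜ (suc zero)    = ≈-mod-1
Qₛ-βₜ (suc (suc n)) = ≈-reflexive
  (cong₂ _+_ (Q-1ₜ (suc n)) (cong (λ x → + 1 + + 2 * x) (Qₛ-1ₜ n)))

1ₜ-HasP : ∀ n → HasP (+ 1) (1ₜ {n})
1ₜ-HasP zero    = leaf
1ₜ-HasP (suc n) = node (≈-reflexive (P-1ₜ {suc n})) (1ₜ-HasP n) (1ₜ-HasP n)

-- At the root of α the sign -1 is made up for by 2 Qₛ(β) = 2.
αₜ-HasP : ∀ n → HasP (+ 1) (αₜ {n})
βₜ-HasP : ∀ n → HasP (+ 1) (βₜ {n})
αₜ-HasP zero    = leaf
αₜ-HasP (suc n) = node
  (+-cong (+-congˡ (- + 1) (double-cong (Qₛ-βₜ n)))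
          (≈-reflexive (cong (λ x → - (+ 2 * x)) (Qₛ-1ₜ n))))
  (1ₜ-HasP n) (βₜ-HasP n)
βₜ-HasP zero    = leaf
βₜ-HasP (suc n) = node
  (≈-reflexive (cong₂ (λ x y → + 1 + + 2 * x - + 2 * y) (Qₛ-αₜ n) (Qₛ-1ₜ n)))
  (1ₜ-HasP n) (αₜ-HasP n)

infixr 7 α·_ β·_

-- As αₜ and βₜ have finite order, positive words suffice to describe Bₙ.
data Generated {n} : Tree n → Set where
  1ᵍ  : Generated 1ₜ
  α·_ : ∀ {τ} → Generated τ → Generated (αₜ · τ)
  β·_ : ∀ {τ} → Generated τ → Generated (βₜ · τ)

Generated-· : ∀ {n} {σ τ : Tree n} → Generated σ → Generated τ → Generated (σ · τ)
Generated-· 1ᵍ     h = subst Generated (sym (·-identityˡ _)) h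
Generated-· (α· g) h = subst Generated (sym (·-assoc αₜ _ _)) (α· Generated-· g h)
Generated-· (β· g) h = subst Generated (sym (·-assoc βₜ _ _)) (β· Generated-· g h)

αᵍ^ : ∀ {n} k → Generated (αₜ {n} ^ₜ k)
αᵍ^ zero    = 1ᵍ
αᵍ^ (suc k) = α· αᵍ^ k

diagonal : ∀ {n} k → Generated {suc n} (node false (βₜ ^ₜ k) (βₜ ^ₜ k))
diagonal k = subst Generated (αₜ-^ₜ k) (αᵍ^ (2 ℕ.* k))

-- Together with `Qₛ-βₜ·` this says that `Qₛ` counts the letters β of a positive word.
Qₛ-αₜ· : ∀ {n} (τ : Tree n) → Qₛ (αₜ · τ) ≈[ ⌊ n /2⌋ ] Qₛ τ
Qₛ-αₜ· {n} τ = ≈-trans (Qₛ-· (αₜ-HasP n) τ)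
  (≈-reflexive (trans (cong (_+ + 1 * Qₛ τ) (Qₛ-αₜ n)) (lem (Qₛ τ))))
  where
  lem : ∀ x → + 0 + + 1 * x ≡ x
  lem = solve-∀

Qₛ-βₜ· : ∀ {n} (τ : Tree n) → Qₛ (βₜ · τ) ≈[ ⌊ n /2⌋ ] + 1 + Qₛ τ
Qₛ-βₜ· {n} τ = ≈-trans (Qₛ-· (βₜ-HasP n) τ)
  (+-cong (Qₛ-βₜ n) (≈-reflexive (ℤₚ.*-identityˡ (Qₛ τ))))

-- Substituting α ↦ β = (1, α), β ↦ α² = (β, β) in a word for y.
lift-right : ∀ {n} {y : Tree n} → Generated y →
  ∃ λ k → Generated (node false (βₜ ^ₜ k) y) × Qₛ y ≈[ ⌊ n /2⌋ ] + k
lift-right {n} 1ᵍ = 0 , 1ᵍ , ≈-reflexive (Qₛ-1ₜ n)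
lift-right (α·_ {y} g) with k , h , Qₛ≈k ← lift-right g =
  k , subst (λ x → Generated (node false x (αₜ · y))) (·-identityˡ _) (β· h) ,
  ≈-trans (Qₛ-αₜ· y) Qₛ≈k
lift-right (β·_ {y} g) with k , h , Qₛ≈k ← lift-right g =
  suc k , subst Generated (αₜ·αₜ· (βₜ ^ₜ k) y) (α· α· h) ,
  ≈-trans (Qₛ-βₜ· y) (+-congˡ (+ 1) Qₛ≈k)

-- αβα = (βα, β), and (β, β) = α² has finite order.
[α,1]-Generated : ∀ n → Generated {suc n} (node false αₜ 1ₜ)
[α,1]-Generated n = subst Generated
  (cong₂ (node false)
    (trans (sym (·-assoc (βₜ ^ₜ m) βₜ αₜ)) (trans (cong (_· αₜ) β^m·β) (·-identityˡ αₜ)))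
    β^m·β)
  (Generated-· (diagonal m) αβα)
  where
  m = ℕ.pred (2 ^ ⌊ n /2⌋)
  β^m·β : βₜ {n} ^ₜ m · βₜ ≡ 1ₜ
  β^m·β = ^ₜ-pred (2 ^ ⌊ n /2⌋) {{ℕₚ.m^n≢0 2 ⌊ n /2⌋}} (βₜ-order n)
  αβα : Generated (node false (βₜ · αₜ) βₜ)
  αβα = subst Generated
    (cong₂ (node false)
      (cong (βₜ ·_) (trans (cong (αₜ ·_) (·-identityˡ 1ₜ)) (·-identityʳ αₜ)))
      (trans (·-identityˡ _) (trans (·-identityˡ _) (·-identityʳ βₜ))))
    (α· β· α· 1ᵍ)

-- Substituting α ↦ (α, 1) and β ↦ α² = (β, β) in a word for x; k is the number of letters β.
lift-left : ∀ {n} {x : Tree n} → Generated x →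
  ∃ λ k → Generated (node false x (βₜ ^ₜ k)) × Qₛ x ≈[ ⌊ n /2⌋ ] + k
lift-left {n} 1ᵍ = 0 , 1ᵍ , ≈-reflexive (Qₛ-1ₜ n)
lift-left {n} (α·_ {x} g) with k , h , Qₛ≈k ← lift-left g =
  k , subst (λ y → Generated (node false (αₜ · x) y)) (·-identityˡ _)
        (Generated-· ([α,1]-Generated n) h) ,
  ≈-trans (Qₛ-αₜ· x) Qₛ≈k
lift-left (β·_ {x} g) with k , h , Qₛ≈k ← lift-left g =
  suc k , subst Generated (αₜ·αₜ· x (βₜ ^ₜ k)) (α· α· h) ,
  ≈-trans (Qₛ-βₜ· x) (+-congˡ (+ 1) Qₛ≈k)

Generated-αₜ· : ∀ {n} {τ : Tree n} → Generated (αₜ · τ) → Generated τ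
Generated-αₜ· {n} {τ} g = subst Generated
  (trans (sym (·-assoc (αₜ ^ₜ m) αₜ τ)) (trans (cong (_· τ) α^m·α) (·-identityˡ τ)))
  (Generated-· (αᵍ^ m) g)
  where
  m = ℕ.pred (2 ^ ⌈ n /2⌉)
  α^m·α : αₜ {n} ^ₜ m · αₜ ≡ 1ₜ
  α^m·α = ^ₜ-pred (2 ^ ⌈ n /2⌉) {{ℕₚ.m^n≢0 2 ⌈ n /2⌉}} (αₜ-order n)

-- (x, y) = (x, β^k) (β^i, β^i) (β^m, y) whenever β^(i+m) and β^(k+i) are trivial.
kernel-Generated : ∀ {n} {τ : Tree n} → HasP (+ 1) τ → Generated τ
kernel-Generated {zero} {leaf} leaf = 1ᵍ
kernel-Generated {suc n} = go _
  where
  fixing : ∀ {x y : Tree n} → HasP (+ 1) (node false x y) → Generated (node false x y)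
  fixing {x} {y} (node P≈1 hx hy)
    with k , g , Qₛx≈k ← lift-left (kernel-Generated hx)
       | m , h , Qₛy≈m ← lift-right (kernel-Generated hy) =
    subst Generated (cong₂ (node false) left right)
      (Generated-· g (Generated-· (diagonal i) h))
    where
    open ≡-Reasoning
    -- A natural number congruent to -k. Since m ≈ k, the same power of (β, β) corrects both
    -- coordinates.
    i = residue (- + k) ⌊ n /2⌋
    Qₛy≈Qₛx : Qₛ y ≈[ ⌊ n /2⌋ ] Qₛ x
    -- With root parity 0, P ≈ 1 reads 2 Qₛ y ≈ 2 Qₛ x.
    Qₛy≈Qₛx = double-cancel (≈-trans (≈-reflexive (lem₁ (Qₛ x) (Qₛ y)))
      (≈-trans (+-congʳ (+ 2 * Qₛ x - + 1) P≈1) (≈-reflexive (lem₂ (Qₛ x)))))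
      where
      lem₁ : ∀ x y → + 2 * y ≡ + 1 + + 2 * y - + 2 * x + (+ 2 * x - + 1)
      lem₁ = solve-∀
      lem₂ : ∀ x → + 1 + (+ 2 * x - + 1) ≡ + 2 * x
      lem₂ = solve-∀
    i≈-k : + i ≈[ ⌊ n /2⌋ ] - + k
    i≈-k = ≈-sym (≈-residue (- + k))
    m≈k : + m ≈[ ⌊ n /2⌋ ] + k
    m≈k = ≈-trans (≈-sym Qₛy≈m) (≈-trans Qₛy≈Qₛx Qₛx≈k)
    i+m≈0 : + (i ℕ.+ m) ≈[ ⌊ n /2⌋ ] + 0
    i+m≈0 = ≈-trans (+-cong i≈-k m≈k) (≈-reflexive (ℤₚ.+-inverseˡ (+ k)))
    k+i≈0 : + (k ℕ.+ i) ≈[ ⌊ n /2⌋ ] + 0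
    k+i≈0 = ≈-trans (+-congˡ (+ k) i≈-k) (≈-reflexive (ℤₚ.+-inverseʳ (+ k)))
    left : x · (βₜ ^ₜ i · βₜ ^ₜ m) ≡ x
    left = begin
      x · (βₜ ^ₜ i · βₜ ^ₜ m) ≡⟨ cong (x ·_) (^ₜ-+ βₜ i m) ⟨
      x · βₜ ^ₜ (i ℕ.+ m)     ≡⟨ cong (x ·_) (βₜ-^ₜ≡1ₜ (i ℕ.+ m) i+m≈0) ⟩
      x · 1ₜ                  ≡⟨ ·-identityʳ x ⟩
      x                       ∎
    right : βₜ ^ₜ k · (βₜ ^ₜ i · y) ≡ y
    right = begin
      βₜ ^ₜ k · (βₜ ^ₜ i · y) ≡⟨ ·-assoc (βₜ ^ₜ k) (βₜ ^ₜ i) y ⟨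
      βₜ ^ₜ k · βₜ ^ₜ i · y   ≡⟨ cong (_· y) (^ₜ-+ βₜ k i) ⟨
      βₜ ^ₜ (k ℕ.+ i) · y     ≡⟨ cong (_· y) (βₜ-^ₜ≡1ₜ (k ℕ.+ i) k+i≈0) ⟩
      1ₜ · y                  ≡⟨ ·-identityˡ y ⟩
      y                       ∎
  go : ∀ τ → HasP (+ 1) τ → Generated τ
  go (node false x y) h = fixing h
  -- Multiplication by α removes the swap at the root and keeps P = 1.
  go (node true x y)  h = Generated-αₜ· (fixing (HasP-· (αₜ-HasP (suc n)) h))

-- The Basilica group and its closure

evenᵇ-suc : ∀ n → evenᵇ (suc n) ≡ oddᵇ n
evenᵇ-suc zero          = refl
evenᵇ-suc (suc zero)    = refl
evenᵇ-suc (suc (suc n)) = evenᵇ-suc n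

oddᵇ-suc : ∀ n → oddᵇ (suc n) ≡ evenᵇ n
oddᵇ-suc zero          = refl
oddᵇ-suc (suc zero)    = refl
oddᵇ-suc (suc (suc n)) = oddᵇ-suc n

restrict-𝛂 : ∀ n → restrict n 𝛂 ≡ αₜ
restrict-𝛃 : ∀ n → restrict n 𝛃 ≡ βₜ
restrict-𝛂 zero    = refl
restrict-𝛂 (suc n) = cong₂ (node true) (restrict-id n)
  (trans (restrict-cong n (λ w _ → cong (allB w ∧_) (evenᵇ-suc (length w)))) (restrict-𝛃 n))
restrict-𝛃 zero    = refl
restrict-𝛃 (suc n) = cong₂ (node false) (restrict-id n)
  (trans (restrict-cong n (λ w _ → cong (allB w ∧_) (oddᵇ-suc (length w)))) (restrict-𝛂 n))

Generated⇒InB : ∀ {n} {τ : Tree n} → Generated τ → InB n τ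
Generated⇒InB {n} 1ᵍ = [] , restrict-id n
Generated⇒InB {n} (α· g) with gs , eq ← Generated⇒InB g =
  α⁺ ∷ gs , trans (restrict-∘ n 𝛂 (eval gs)) (cong₂ _·_ (restrict-𝛂 n) eq)
Generated⇒InB {n} (β· g) with gs , eq ← Generated⇒InB g =
  β⁺ ∷ gs , trans (restrict-∘ n 𝛃 (eval gs)) (cong₂ _·_ (restrict-𝛃 n) eq)

gen-HasP : ∀ n g → HasP (+ 1) (restrict n (gen g))
gen-HasP n α⁺ = subst (HasP (+ 1)) (sym (restrict-𝛂 n)) (αₜ-HasP n)
gen-HasP n α⁻ = subst (HasP (+ 1)) (sym (restrict-inv n 𝛂)) (HasP-inv ≈-refl (gen-HasP n α⁺))
gen-HasP n β⁺ = subst (HasP (+ 1)) (sym (restrict-𝛃 n)) (βₜ-HasP n)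
gen-HasP n β⁻ = subst (HasP (+ 1)) (sym (restrict-inv n 𝛃)) (HasP-inv ≈-refl (gen-HasP n β⁺))

eval-HasP : ∀ n gs → HasP (+ 1) (restrict n (eval gs))
eval-HasP n []       = subst (HasP (+ 1)) (sym (restrict-id n)) (1ₜ-HasP n)
eval-HasP n (g ∷ gs) = subst (HasP (+ 1)) (sym (restrict-∘ n (gen g) (eval gs)))
  (HasP-· (gen-HasP n g) (eval-HasP n gs))

-- The parity at a node shows in the image of that node extended by a, so the action on words of
-- length at most m determines the parities at all shorter nodes.
act⇒restrict : ∀ m {σ τ : Aut∞} → (∀ w → length w ≤ m → act σ w ≡ act τ w) →
               restrict m σ ≡ restrict m τ
act⇒restrict zero    h = refl
act⇒restrict (suc m) {σ} {τ} h
  rewrite ∷-injectiveˡ (h (a ∷ []) (s≤s z≤n)) = cong₂ (node (τ []))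
    (act⇒restrict m (λ w w≤m → ∷-injectiveʳ (h (a ∷ w) (s≤s w≤m))))
    (act⇒restrict m (λ w w≤m → ∷-injectiveʳ (h (b ∷ w) (s≤s w≤m))))

node-injective : ∀ {n c d} {l r x y : Tree n} → node c l r ≡ node d x y →
                 c ≡ d × l ≡ x × r ≡ y
node-injective refl = refl , refl , refl

restrict⇒act : ∀ m {σ τ : Aut∞} → restrict m σ ≡ restrict m τ →
               ∀ w → length w ≤ m → act σ w ≡ act τ w
restrict⇒act m eq [] _ = refl
restrict⇒act (suc m) {σ} {τ} eq (c ∷ w) (s≤s w≤m) with p , l , r ← node-injective eq =
  cong₂ _∷_ (cong (c xor_) p) (restrict⇒act m (child c) w w≤m)
  where
  child : ∀ c → restrict m (section σ c) ≡ restrict m (section τ c)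
  child false = l
  child true  = r

-- Both sides are tested level by level: σ lies in the closure when every restriction of σ lies in
-- Bₘ, and by `kernel-Generated` this means that P is 1 at all nodes to the precision available.
M∞-kernel : ∀ σ → InClosureB σ ⇔ (InM∞ σ × (∀ k → Pmod σ [] k ≡ modPow 1 k))
M∞-kernel σ = mk⇔ f g
  where
  f : InClosureB σ → InM∞ σ × (∀ k → Pmod σ [] k ≡ modPow 1 k)
  f closure = HasP⇒InM∞ σ-HasP , λ k → trans (Pmod-restrict-2k k σ)
    (residue-cong {k} {P (restrict (2 ℕ.* k) σ)} {+ 1}
      (subst (λ j → P (restrict (2 ℕ.* k) σ) ≈[ j ] + 1)
      (trans (sym (jj≡⌈n/2⌉ (2 ℕ.* k))) (expo-[m+2k]-m 0 k)) (HasP-P (σ-HasP (2 ℕ.* k)))))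
    where
    σ-HasP : ∀ n → HasP (+ 1) (restrict n σ)
    σ-HasP n with gs , agree ← closure n =
      subst (HasP (+ 1)) (act⇒restrict n agree) (eval-HasP n gs)
  g : InM∞ σ × (∀ k → Pmod σ [] k ≡ modPow 1 k) → InClosureB σ
  g (σ∈M , Pσ≡1) m = proj₁ σ∈Bₘ , restrict⇒act m (proj₂ σ∈Bₘ)
    where
    P≈1 : P (restrict m σ) ≈[ jj m ] + 1
    P≈1 = ≈-trans (P-restrict-jj m σ)
      (residue-injective {jj m} {Pint σ [] (jj m)} {+ 1} (Pσ≡1 (jj m)))
    σ∈Bₘ : InB m (restrict m σ)
    σ∈Bₘ = Generated⇒InB (kernel-Generated (HasP-resp
      (subst (λ k → P (restrict m σ) ≈[ k ] + 1) (jj≡⌈n/2⌉ m) P≈1) (InM∞⇒HasP σ∈M m)))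

Mₙ-kernel : ∀ n → 1 ≤ n → ∀ τ → InB n τ ⇔ (InM n τ × Pmod (ext τ) [] (jj n) ≡ 1)
Mₙ-kernel n 1≤n τ = mk⇔ f g
  where
  -- As n ≥ 1, the modulus is at least 2 and 1 is its own residue.
  1<2^jj : 1 < 2 ^ jj n
  1<2^jj = ℕₚ.^-monoʳ-≤ 2 {1} (ℕₚ./-monoˡ-≤ 2 (ℕₚ.+-monoˡ-≤ 1 1≤n))
  residue≡1 : Pmod (ext τ) [] (jj n) ≡ 1 → residue (P τ) (jj n) ≡ 1
  residue≡1 eq = trans (sym (Pmod-ext τ)) eq
  P≈1 : residue (P τ) (jj n) ≡ 1 → P τ ≈[ jj n ] + 1
  P≈1 eq = subst (λ i → P τ ≈[ jj n ] + i) eq (≈-residue (P τ))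
  f : InB n τ → InM n τ × Pmod (ext τ) [] (jj n) ≡ 1
  f (gs , eq) = HasP⇒InM τ h , trans (Pmod-ext τ) (residue-unique {jj n} {P τ} 1<2^jj
    (subst (λ k → P τ ≈[ k ] + 1) (sym (jj≡⌈n/2⌉ n)) (HasP-P h)))
    where
    h : HasP (+ 1) τ
    h = subst (HasP (+ 1)) eq (eval-HasP n gs)
  g : InM n τ × Pmod (ext τ) [] (jj n) ≡ 1 → InB n τ
  g (τ∈M , eq) = Generated⇒InB (kernel-Generated (HasP-resp
    (subst (λ k → P τ ≈[ k ] + 1) (jj≡⌈n/2⌉ n) (P≈1 (residue≡1 eq))) (InM⇒HasP τ τ∈M)))

theorem4p6 :
    -- M∞ is a subgroup of Aut(T∞)
    (∀ σ τ → InM∞ σ → InM∞ τ → InM∞ (σ ∘ᵃ τ))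
    × (∀ σ → InM∞ σ → InM∞ (invᵃ σ))
    -- P : M∞ → ℤ₂ˣ is a homomorphism
    × (∀ σ τ → InM∞ σ → InM∞ τ → ∀ k →
         Pmod (σ ∘ᵃ τ) [] k ≡ modPow (Pmod σ [] k ℕ.* Pmod τ [] k) k)
    -- P is surjective onto ℤ₂ˣ
    × (∀ (u : ℤ₂) → IsUnit₂ u → ∃[ σ ] (InM∞ σ × (∀ k → Pmod σ [] k ≡ val u k)))
    -- kernel of P equals the closure of B∞
    × (∀ σ → InClosureB σ ⇔ (InM∞ σ × (∀ k → Pmod σ [] k ≡ modPow 1 k)))
    -- finite levels n ≥ 1
    × (∀ (n : ℕ) → 1 ≤ n →
         -- M_n is a subgroup of Aut(T_n)
         (∀ τ υ → InM n τ → InM n υ → InM n (τ ∘ₙ υ))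
         × (∀ τ → InM n τ → InM n (invₙ τ))
         -- P : M_n → (ℤ/2^j)ˣ is a homomorphism
         × (∀ τ υ → InM n τ → InM n υ →
              Pmod (ext (τ ∘ₙ υ)) [] (jj n)
                ≡ modPow (Pmod (ext τ) [] (jj n) ℕ.* Pmod (ext υ) [] (jj n)) (jj n))
         -- P is surjective onto (ℤ/2^j)ˣ
         × (∀ (u : ℕ) → u < 2 ^ jj n → u % 2 ≡ 1 →
              ∃[ τ ] (InM n τ × Pmod (ext τ) [] (jj n) ≡ u))
         -- kernel of P equals B_n
         × (∀ τ → InB n τ ⇔ (InM n τ × Pmod (ext τ) [] (jj n) ≡ 1))
         -- |M_n| = 2^{m_n}
         × HasCard (InM n) (2 ^ mExp n))
theorem4p6 =
  M∞-∘ , M∞-inv , M∞-homo , M∞-surjective , M∞-kernel ,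
  λ { n@(suc m) 1≤n → Mₙ-∘ , Mₙ-inv , Mₙ-homo , Mₙ-surjective n , Mₙ-kernel n 1≤n , HasCard-M m }
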